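{- Consider the Downward-Closed Secretary problem in which all item values satisfy $y_i\in\{0,1\}$. There is a deterministic online algorithm for this problem that achieves a competitive ratio of $O(\log n)$.
   Context: Downward-Closed Secretary: there are $n$ items with values $y_i\ge 0$ and a downward-closed family $\mathcal{F}$ of subsets of the items (the feasible sets); both the values and $\mathcal{F}$ are chosen adversarially. The algorithm receives $n$ as input (but not $\mathcal{F}$ or the values). The items arrive in a uniformly random order. Starting with $W=\emptyset$, when an item arrives the algorithm observes its value and all feasible sets that it forms together with previously arrived items, and then decides immediately and irrevocably whether to add it to $W$, subject to $W$ remaining in $\mathcal{F}$. The algorithm's value is $\sum_{i\in W}y_i$. The competitive ratio is the worst case, over instances, of $\max_{S\in\mathcal{F}}\sum_{i\in S}y_i$ divided by the expected value of the algorithm (expectation over the random arrival order). -}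

module Defs where

open import Data.Bool using (Bool; true; false; if_then_else_; _∧_)
open import Data.Nat using (ℕ; zero; suc; _+_)
open import Data.Fin using (Fin)
open import Data.Fin.Subset using (Subset; _⊆_; ⁅_⁆; _∪_; ⊥)
open import Data.List using (List; []; _∷_; concatMap; map; allFin)
open import Data.Nat.ListAction using (sum)
open import Data.Vec using (Vec; []; _∷_; lookup; _∷ʳ_; tabulate)
import Data.Vec as Vec
open import Relation.Binary.PropositionalEquality using (_≡_)

Family : ℕ → Set
Family n = Subset n → Bool

DownwardClosed : ∀ {n} → Family n → Set
DownwardClosed {n} F = (S T : Subset n) → S ⊆ T → F T ≡ true → F S ≡ true

setValue : ∀ {n} → (Fin n → ℕ) → Subset n → ℕ
setValue {n} y S = Data.Vec.foldr _ _+_ 0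
  (tabulate (λ i → if lookup S i then y i else 0))

insertEverywhere : {A : Set} → A → List A → List (List A)
insertEverywhere x []       = (x ∷ []) ∷ []
insertEverywhere x (y ∷ ys) = (x ∷ y ∷ ys) ∷ map (y ∷_) (insertEverywhere x ys)

permutations : {A : Set} → List A → List (List A)
permutations []       = [] ∷ []
permutations (x ∷ xs) = concatMap (insertEverywhere x) (permutations xs)

arrivalOrders : (n : ℕ) → List (List (Fin n))
arrivalOrders n = permutations (allFin n)

image : ∀ {n k} → Vec (Fin n) k → Subset k → Subset n
image []       []       = ⊥
image (a ∷ as) (b ∷ bs) = (if b then ⁅ a ⁆ else ⊥) ∪ image as bs

-- A deterministic online algorithm.  It knows n.  When the (k+1)-st item
-- arrives (k items arrived before) it sees, indexed by arrival position:
--   * the values of all k+1 arrived items,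
--   * which sets of arrived items are feasible,
--   * its own previous k decisions,
-- and answers whether to accept the new item.
OnlineAlg : Set
OnlineAlg = (n k : ℕ) → Vec ℕ (suc k) → (Subset (suc k) → Bool) → Vec Bool k → Bool

-- Running the algorithm.  An acceptance is carried out only if W stays
-- feasible (the algorithm sees the feasibility of W ∪ {new} anyway).
-- Returns the total value of the selected set W.
run : ∀ {n} → OnlineAlg → (Fin n → ℕ) → Family n →
      (k : ℕ) → Vec (Fin n) k → Vec Bool k → Subset n → List (Fin n) → ℕ
run {n} A y F k arrived decisions W [] = setValue y W
run {n} A y F k arrived decisions W (a ∷ rest) =
  run A y F (suc k) arrived' (decisions ∷ʳ accept) W' rest
  where
    arrived' : Vec (Fin n) (suc k)
    arrived' = arrived ∷ʳ a
    d : Bool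
    d = A n k (Vec.map y arrived') (λ T → F (image arrived' T)) decisions
    accept : Bool
    accept = d ∧ F (W ∪ ⁅ a ⁆)
    W' : Subset n
    W' = if accept then W ∪ ⁅ a ⁆ else W

algValue : ∀ {n} → OnlineAlg → (Fin n → ℕ) → Family n → List (Fin n) → ℕ
algValue A y F order = run A y F 0 [] [] ⊥ order

-- Σ over all n! arrival orders of the algorithm's value
-- (= n! · expected value under a uniformly random order)
totalAlgValue : ∀ {n} → OnlineAlg → (Fin n → ℕ) → Family n → ℕ
totalAlgValue {n} A y F = sum (map (algValue A y F) (arrivalOrders n))

{-# OPTIONS --safe #-}
module Submission where

-- Let Ψ(A, W) be the number of sets T of value-1 items of A with W ∪ T feasible,
-- and call a good for (A, W) if Ψ(A, W) < 2^q y_a Ψ(A, W ∪ a), where 2^q > 2n.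
-- The algorithm skips the first ⌊n/2⌋ arrivals and then accepts exactly the items
-- that are good for the arrived set A and its current selection W.  Each acceptance
-- costs a factor of at most 2^q in Ψ, and Ψ only grows with A, so Ψ stays above
-- 2^(k′ - q |W|) with k′ the number of sampled items of an optimal set; and if
-- Ψ(A, W) ≥ 2^h, at least h items of A are good.
--
-- Fix a set V and suppose that the algorithm ends with V.  Its selection at each
-- time is then V ∩ A, so every late arrival outside V fails to be good for
-- (A, V ∩ A), a condition on the unordered set A and its last element.  Exposing
-- the order backwards, the last element of A is uniform in A, so if at least g
-- items of A \ V are good throughout, this has probability at most 2^-g.  A union
-- bound over V shows k′ ≤ 3q (|V| + 1) outside an event of probability ≤ 1/16.  The
-- same bound for V = ∅ and g = 1 shows that some item is selected with probability
-- at least 1/2, which absorbs the "+ 1".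

open import Defs
open import Data.Bool using (Bool; true; false; if_then_else_; T; _∧_; _∨_; not)
open import Data.Bool.Properties using (∧-assoc; ∨-identityʳ)
open import Data.Empty using (⊥-elim)
open import Data.Fin using (Fin; zero; suc)
open import Data.Fin.Subset using (Subset; ∣_∣; ⊥; ⁅_⁆; _∪_; _⊆_)
open import Data.Fin.Subset.Properties
  using (∪-assoc; ∪-comm; ∪-idem; ∪-identityˡ; ∪-identityʳ; p⊆p∪q; q⊆p∪q; x∈p∪q⁻; x∈⁅x⁆; x∈⁅y⁆⇒x≡y; x≢y⇒x∉⁅y⁆)
open import Data.List
  using (List; []; _∷_; _++_; _ʳ++_; map; concatMap; length; reverse; allFin; tabulate) renaming (_∷ʳ_ to _∷ʳₗ_)
open import Data.List.Properties using (map-cong; map-∘; map-++; map-tabulate; length-tabulate; unfold-reverse)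
open import Data.List.Membership.Propositional using (_∈_; _∉_)
open import Data.List.Relation.Unary.All as All using (All; []; _∷_)
open import Data.List.Relation.Unary.All.Properties using (map⁺)
open import Data.List.Relation.Unary.Any using (here; there)
open import Data.List.Relation.Unary.Unique.Propositional using (Unique; []; _∷_)
open import Data.List.Relation.Unary.Unique.Propositional.Properties using (allFin⁺)
open import Data.List.Relation.Binary.Permutation.Propositional
  using (_↭_; ↭-trans; ↭-sym; ↭⇒↭ₛ; prep; swap; refl; trans)
open import Data.List.Relation.Binary.Permutation.Propositional.Properties using (↭-length) renaming (map⁺ to ↭-map⁺)
open import Data.List.Relation.Binary.Permutation.Setoid.Properties using (Unique-resp-↭)
open import Data.Nat
  using (ℕ; zero; suc; _+_; _*_; _∸_; _^_; _≤_; _<_; _!; z≤n; s≤s; _≤ᵇ_; _<ᵇ_; _≤?_; ⌊_/2⌋; >-nonZero)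
open import Data.Nat.ListAction using (sum)
open import Data.Nat.ListAction.Properties using (sum-++; sum-↭)
open import Data.Nat.Logarithm using (⌊log₂_⌋; ⌊log₂⌋-mono-≤; ⌊log₂[2^n]⌋≡n)
open import Data.Nat.Properties
open import Data.Nat.Tactic.RingSolver using (solve-∀)
open import Data.Product using (Σ; ∃; _×_; _,_; proj₁)
open import Data.Sum using (inj₁; inj₂)
open import Data.Unit using (tt)
open import Data.Vec as Vec using (Vec; []; _∷_; _∷ʳ_; lookup; toList)
open import Data.Vec.Properties
  using (map-∷ʳ; last-∷ʳ; length-toList; lookup-zipWith; lookup-replicate; lookup⇒[]=; []=⇒lookup)
open import Function using (_∘_; const)
open import Relation.Nullary using (yes; no; ¬_; contradiction)
open import Relation.Binary.PropositionalEquality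
  using (_≡_; _≢_; refl; sym; cong; cong₂; subst; subst₂; module ≡-Reasoning; setoid)
import Relation.Binary.PropositionalEquality as ≡

private variable
  A B : Set

-- Finite sums over lists

∑ : List A → (A → ℕ) → ℕ
∑ xs f = sum (map f xs)

∑-cong : (xs : List A) {f g : A → ℕ} → (∀ x → f x ≡ g x) → ∑ xs f ≡ ∑ xs g
∑-cong xs f≗g = cong sum (map-cong f≗g xs)

∑-cong-All : {xs : List A} {f g : A → ℕ} → All (λ x → f x ≡ g x) xs → ∑ xs f ≡ ∑ xs g
∑-cong-All []       = refl
∑-cong-All (p ∷ ps) = cong₂ _+_ p (∑-cong-All ps)

∑-mono-All : {xs : List A} {f g : A → ℕ} → All (λ x → f x ≤ g x) xs → ∑ xs f ≤ ∑ xs g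
∑-mono-All []       = z≤n
∑-mono-All (p ∷ ps) = +-mono-≤ p (∑-mono-All ps)

∑-mono : (xs : List A) {f g : A → ℕ} → (∀ x → f x ≤ g x) → ∑ xs f ≤ ∑ xs g
∑-mono xs f≤g = ∑-mono-All (All.universal f≤g xs)

∑-map : (g : A → B) (xs : List A) {f : B → ℕ} → ∑ (map g xs) f ≡ ∑ xs (f ∘ g)
∑-map g xs = cong sum (sym (map-∘ xs))

∑-↭ : {xs ys : List A} (f : A → ℕ) → xs ↭ ys → ∑ xs f ≡ ∑ ys f
∑-↭ f xs↭ys = sum-↭ (↭-map⁺ f xs↭ys)

∑-+ : (xs : List A) (f g : A → ℕ) → ∑ xs (λ x → f x + g x) ≡ ∑ xs f + ∑ xs g
∑-+ []       f g = refl
∑-+ (x ∷ xs) f g = ≡.trans (cong (f x + g x +_) (∑-+ xs f g)) (interchange (f x) (g x) _ _)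
  where
  interchange : ∀ a b c d → a + b + (c + d) ≡ a + c + (b + d)
  interchange = solve-∀

∑-*ˡ : (c : ℕ) (xs : List A) (f : A → ℕ) → ∑ xs (λ x → c * f x) ≡ c * ∑ xs f
∑-*ˡ c []       f = sym (*-zeroʳ c)
∑-*ˡ c (x ∷ xs) f = ≡.trans (cong (c * f x +_) (∑-*ˡ c xs f)) (sym (*-distribˡ-+ c (f x) _))

∑-*ʳ : (c : ℕ) (xs : List A) (f : A → ℕ) → ∑ xs (λ x → f x * c) ≡ ∑ xs f * c
∑-*ʳ c xs f = ≡.trans (∑-cong xs (λ x → *-comm (f x) c)) (≡.trans (∑-*ˡ c xs f) (*-comm c _))

∑-const : (c : ℕ) (xs : List A) → ∑ xs (const c) ≡ length xs * c
∑-const c []       = refl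
∑-const c (x ∷ xs) = cong (c +_) (∑-const c xs)

∑-zero : (xs : List A) → ∑ xs (const 0) ≡ 0
∑-zero []       = refl
∑-zero (x ∷ xs) = ∑-zero xs

∑-++ : (xs ys : List A) (f : A → ℕ) → ∑ (xs ++ ys) f ≡ ∑ xs f + ∑ ys f
∑-++ xs ys f = ≡.trans (cong sum (map-++ f xs ys)) (sum-++ (map f xs) (map f ys))

∑-concatMap : (g : A → List B) (xs : List A) (f : B → ℕ) →
              ∑ (concatMap g xs) f ≡ ∑ xs (λ x → ∑ (g x) f)
∑-concatMap g []       f = refl
∑-concatMap g (x ∷ xs) f = ≡.trans (∑-++ (g x) (concatMap g xs) f) (cong (∑ (g x) f +_) (∑-concatMap g xs f))

-- Backward exposure of a uniformly random order

picks : List A → List (A × List A)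
picks []       = []
picks (x ∷ xs) = (x , xs) ∷ map (λ (a , r) → a , x ∷ r) (picks xs)

picks-↭ : (xs : List A) → All (λ (a , r) → a ∷ r ↭ xs) (picks xs)
picks-↭ []       = []
picks-↭ (x ∷ xs) = refl ∷ map⁺ (All.map (λ {(a , r)} p → ↭-trans (swap a x refl) (prep x p)) (picks-↭ xs))

∑-picks : (xs : List A) (f : A → ℕ) → ∑ (picks xs) (f ∘ proj₁) ≡ ∑ xs f
∑-picks []       f = refl
∑-picks (x ∷ xs) f = cong (f x +_) (≡.trans (∑-map _ (picks xs)) (∑-picks xs f))

-- Each element is missing from exactly one of the remainders, so it is counted once for each of the
-- `length xs` others.
∑-picks-∑ : (x : A) (xs : List A) (s : A → ℕ) →
            ∑ (picks (x ∷ xs)) (λ (_ , r) → ∑ r s) ≡ length xs * ∑ (x ∷ xs) s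
∑-picks-∑ x []       s = refl
∑-picks-∑ x (z ∷ zs) s = begin
  ∑ xs s + ∑ (map _ (picks xs)) (λ (_ , r) → ∑ r s)
    ≡⟨ cong (∑ xs s +_) (∑-map _ (picks xs)) ⟩
  ∑ xs s + ∑ (picks xs) (λ (_ , r) → s x + ∑ r s)
    ≡⟨ cong (∑ xs s +_) (∑-+ (picks xs) (const (s x)) (λ (_ , r) → ∑ r s)) ⟩
  ∑ xs s + (∑ (picks xs) (const (s x)) + ∑ (picks xs) (λ (_ , r) → ∑ r s))
    ≡⟨ cong₂ (λ u v → ∑ xs s + (u + v)) (≡.trans (∑-picks xs (const (s x))) (∑-const (s x) xs)) (∑-picks-∑ z zs s) ⟩
  ∑ xs s + (length xs * s x + length zs * ∑ xs s)
    ≡⟨ regroup (∑ xs s) (length zs) (s x) ⟩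
  length xs * (s x + ∑ xs s) ∎
  where
  open ≡-Reasoning
  xs = z ∷ zs
  regroup : ∀ u l a → u + (suc l * a + l * u) ≡ suc l * (a + u)
  regroup = solve-∀

-- The sum of φ over the orders of the m elements of xs, each given as its
-- history: the reversed order, most recent arrival first.
∑-histories : ℕ → List A → (List A → ℕ) → ℕ
∑-histories zero    xs φ = φ []
∑-histories (suc m) xs φ = ∑ (picks xs) (λ (a , r) → ∑-histories m r (φ ∘ (a ∷_)))

∑-histories-cong : ∀ m (xs : List A) {φ ψ : List A → ℕ} → (∀ ρ → φ ρ ≡ ψ ρ) →
  ∑-histories m xs φ ≡ ∑-histories m xs ψ
∑-histories-cong zero    xs φ≗ψ = φ≗ψ []
∑-histories-cong (suc m) xs φ≗ψ = ∑-cong (picks xs) (λ (a , r) → ∑-histories-cong m r (φ≗ψ ∘ (a ∷_)))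

∑-histories-+ : ∀ m (xs : List A) φ ψ →
  ∑-histories m xs (λ ρ → φ ρ + ψ ρ) ≡ ∑-histories m xs φ + ∑-histories m xs ψ
∑-histories-+ zero    xs φ ψ = refl
∑-histories-+ (suc m) xs φ ψ =
  ≡.trans (∑-cong (picks xs) (λ (a , r) → ∑-histories-+ m r (φ ∘ (a ∷_)) (ψ ∘ (a ∷_)))) (∑-+ (picks xs) _ _)

∑-histories-*ˡ : ∀ c m (xs : List A) φ →
  ∑-histories m xs (λ ρ → c * φ ρ) ≡ c * ∑-histories m xs φ
∑-histories-*ˡ c zero    xs φ = refl
∑-histories-*ˡ c (suc m) xs φ =
  ≡.trans (∑-cong (picks xs) (λ (a , r) → ∑-histories-*ˡ c m r (φ ∘ (a ∷_)))) (∑-*ˡ c (picks xs) _)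

pick-length : ∀ {m} {a : A} {r xs : List A} → length xs ≡ suc m → a ∷ r ↭ xs → length r ≡ m
pick-length l p = suc-injective (≡.trans (↭-length p) l)

∑-histories-mono : ∀ m (xs : List A) {φ ψ} → length xs ≡ m →
  (∀ ρ → ρ ↭ xs → φ ρ ≤ ψ ρ) → ∑-histories m xs φ ≤ ∑-histories m xs ψ
∑-histories-mono zero    []  l φ≤ψ = φ≤ψ [] refl
∑-histories-mono (suc m) xs l φ≤ψ = ∑-mono-All (All.map
  (λ {(a , r)} p → ∑-histories-mono m r (pick-length l p)
                     (λ ρ q → φ≤ψ (a ∷ ρ) (↭-trans (prep a q) p)))
  (picks-↭ xs))

∑-histories-const : ∀ m (xs : List A) c → length xs ≡ m → ∑-histories m xs (const c) ≡ m ! * c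
∑-histories-const zero    xs c l = sym (+-identityʳ c)
∑-histories-const (suc m) xs c l = begin
  ∑ (picks xs) (λ (_ , r) → ∑-histories m r (const c))
    ≡⟨ ∑-cong-All (All.map (λ {(a , r)} p → ∑-histories-const m r c (pick-length l p)) (picks-↭ xs)) ⟩
  ∑ (picks xs) (const (m ! * c))  ≡⟨ ∑-picks xs (const (m ! * c)) ⟩
  ∑ xs (const (m ! * c))          ≡⟨ ∑-const (m ! * c) xs ⟩
  length xs * (m ! * c)           ≡⟨ cong (_* (m ! * c)) l ⟩
  suc m * (m ! * c)               ≡⟨ *-assoc (suc m) (m !) c ⟨
  suc m ! * c                     ∎
  where open ≡-Reasoning

∑-histories-∑ : ∀ m (xs : List A) (vs : List B) (φ : B → List A → ℕ) →
  ∑-histories m xs (λ ρ → ∑ vs (λ v → φ v ρ)) ≡ ∑ vs (λ v → ∑-histories m xs (φ v))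
∑-histories-∑ m xs []       φ = zeros m xs
  where
  zeros : ∀ m (xs : List A) → ∑-histories m xs (const 0) ≡ 0
  zeros zero    xs = refl
  zeros (suc m) xs = ≡.trans (∑-cong (picks xs) (λ (_ , r) → zeros m r)) (∑-zero (picks xs))
∑-histories-∑ m xs (v ∷ vs) φ =
  ≡.trans (∑-histories-+ m xs (φ v) _) (cong (∑-histories m xs (φ v) +_) (∑-histories-∑ m xs vs φ))

∑-insert : A → (List A → ℕ) → List A → ℕ
∑-insert x φ ρ = ∑ (insertEverywhere x ρ) φ

∑-insert-∷ : ∀ (x : A) φ a ρ → ∑-insert x φ (a ∷ ρ) ≡ φ (x ∷ a ∷ ρ) + ∑-insert x (φ ∘ (a ∷_)) ρ
∑-insert-∷ x φ a ρ = cong (φ (x ∷ a ∷ ρ) +_) (∑-map (a ∷_) (insertEverywhere x ρ))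

∑-insert-∷ʳ : ∀ (x : A) φ π a →
  ∑-insert x φ (π ∷ʳₗ a) ≡ ∑-insert x (φ ∘ (_∷ʳₗ a)) π + φ (π ∷ʳₗ a ∷ʳₗ x)
∑-insert-∷ʳ x φ []      a = ≡.trans (cong (φ (x ∷ a ∷ []) +_) (+-identityʳ _)) (cong (_+ φ (a ∷ x ∷ [])) (sym (+-identityʳ _)))
∑-insert-∷ʳ x φ (b ∷ π) a = begin
  ∑-insert x φ (b ∷ π ∷ʳₗ a)
    ≡⟨ ∑-insert-∷ x φ b (π ∷ʳₗ a) ⟩
  φ (x ∷ b ∷ π ∷ʳₗ a) + ∑-insert x (φ ∘ (b ∷_)) (π ∷ʳₗ a)
    ≡⟨ cong (φ (x ∷ b ∷ π ∷ʳₗ a) +_) (∑-insert-∷ʳ x (φ ∘ (b ∷_)) π a) ⟩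
  φ (x ∷ b ∷ π ∷ʳₗ a) + (∑-insert x (λ τ → φ (b ∷ τ ∷ʳₗ a)) π + φ (b ∷ π ∷ʳₗ a ∷ʳₗ x))
    ≡⟨ +-assoc (φ (x ∷ b ∷ π ∷ʳₗ a)) _ _ ⟨
  φ (x ∷ b ∷ π ∷ʳₗ a) + ∑-insert x (λ τ → φ (b ∷ τ ∷ʳₗ a)) π + φ (b ∷ π ∷ʳₗ a ∷ʳₗ x)
    ≡⟨ cong (_+ φ (b ∷ π ∷ʳₗ a ∷ʳₗ x)) (∑-insert-∷ x (φ ∘ (_∷ʳₗ a)) b π) ⟨
  ∑-insert x (φ ∘ (_∷ʳₗ a)) (b ∷ π) + φ (b ∷ π ∷ʳₗ a ∷ʳₗ x) ∎
  where open ≡-Reasoning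

-- Listed orders begin with the first arrival, histories with the last. Inserting at every position
-- is symmetric under reversal, which lets the two recursions be compared.
∑-insert-reverse : ∀ (x : A) φ π → ∑-insert x (φ ∘ reverse) π ≡ ∑-insert x φ (reverse π)
∑-insert-reverse x φ []      = refl
∑-insert-reverse x φ (a ∷ π) = begin
  ∑-insert x (φ ∘ reverse) (a ∷ π)
    ≡⟨ ∑-insert-∷ x (φ ∘ reverse) a π ⟩
  φ (reverse (x ∷ a ∷ π)) + ∑-insert x (λ τ → φ (reverse (a ∷ τ))) π
    ≡⟨ cong₂ _+_ (cong φ (≡.trans (unfold-reverse x (a ∷ π)) (cong (_∷ʳₗ x) (unfold-reverse a π))))
                 (∑-cong (insertEverywhere x π) (λ τ → cong φ (unfold-reverse a τ))) ⟩
  φ (reverse π ∷ʳₗ a ∷ʳₗ x) + ∑-insert x (λ τ → φ (reverse τ ∷ʳₗ a)) π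
    ≡⟨ cong (φ (reverse π ∷ʳₗ a ∷ʳₗ x) +_) (∑-insert-reverse x (φ ∘ (_∷ʳₗ a)) π) ⟩
  φ (reverse π ∷ʳₗ a ∷ʳₗ x) + ∑-insert x (φ ∘ (_∷ʳₗ a)) (reverse π)
    ≡⟨ +-comm (φ (reverse π ∷ʳₗ a ∷ʳₗ x)) _ ⟩
  ∑-insert x (φ ∘ (_∷ʳₗ a)) (reverse π) + φ (reverse π ∷ʳₗ a ∷ʳₗ x)
    ≡⟨ ∑-insert-∷ʳ x φ (reverse π) a ⟨
  ∑-insert x φ (reverse π ∷ʳₗ a)
    ≡⟨ cong (∑-insert x φ) (unfold-reverse a π) ⟨
  ∑-insert x φ (reverse (a ∷ π)) ∎
  where open ≡-Reasoning

-- Either `x` heads the history, or some `a` of `xs` does and `x` is inserted behind it;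
-- `picks (x ∷ xs)` makes the same distinction.
∑-histories-insert : ∀ m (x : A) xs φ → length xs ≡ m →
  ∑-histories m xs (∑-insert x φ) ≡ ∑-histories (suc m) (x ∷ xs) φ
∑-histories-insert zero    x []  φ l = refl
∑-histories-insert (suc m) x xs φ l = begin
  ∑ (picks xs) (λ (a , r) → ∑-histories m r (∑-insert x φ ∘ (a ∷_)))
    ≡⟨ ∑-cong-All (All.map (λ {(a , r)} p → step a r (pick-length l p)) (picks-↭ xs)) ⟩
  ∑ (picks xs) (λ (a , r) → ∑-histories m r (λ ρ → φ (x ∷ a ∷ ρ)) + ∑-histories (suc m) (x ∷ r) (φ ∘ (a ∷_)))
    ≡⟨ ∑-+ (picks xs) (λ (a , r) → ∑-histories m r (λ ρ → φ (x ∷ a ∷ ρ))) _ ⟩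
  ∑-histories (suc m) xs (φ ∘ (x ∷_)) + ∑ (picks xs) (λ (a , r) → ∑-histories (suc m) (x ∷ r) (φ ∘ (a ∷_)))
    ≡⟨ cong (∑-histories (suc m) xs (φ ∘ (x ∷_)) +_) (∑-map (λ (a , r) → a , x ∷ r) (picks xs)) ⟨
  ∑-histories (suc (suc m)) (x ∷ xs) φ ∎
  where
  open ≡-Reasoning
  step : ∀ a r → length r ≡ m → ∑-histories m r (∑-insert x φ ∘ (a ∷_)) ≡
    ∑-histories m r (λ ρ → φ (x ∷ a ∷ ρ)) + ∑-histories (suc m) (x ∷ r) (φ ∘ (a ∷_))
  step a r l′ = begin
    ∑-histories m r (∑-insert x φ ∘ (a ∷_))
      ≡⟨ ∑-histories-cong m r (∑-insert-∷ x φ a) ⟩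
    ∑-histories m r (λ ρ → φ (x ∷ a ∷ ρ) + ∑-insert x (φ ∘ (a ∷_)) ρ)
      ≡⟨ ∑-histories-+ m r (λ ρ → φ (x ∷ a ∷ ρ)) _ ⟩
    ∑-histories m r (λ ρ → φ (x ∷ a ∷ ρ)) + ∑-histories m r (∑-insert x (φ ∘ (a ∷_)))
      ≡⟨ cong (∑-histories m r (λ ρ → φ (x ∷ a ∷ ρ)) +_) (∑-histories-insert m x r (φ ∘ (a ∷_)) l′) ⟩
    ∑-histories m r (λ ρ → φ (x ∷ a ∷ ρ)) + ∑-histories (suc m) (x ∷ r) (φ ∘ (a ∷_)) ∎

-- Averages over `arrivalOrders` can thus be computed by exposing the last arrival first.
∑-permutations : (xs : List A) (φ : List A → ℕ) →
  ∑ (permutations xs) (φ ∘ reverse) ≡ ∑-histories (length xs) xs φ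
∑-permutations []       φ = +-identityʳ _
∑-permutations (x ∷ xs) φ = begin
  ∑ (permutations (x ∷ xs)) (φ ∘ reverse)
    ≡⟨ ∑-concatMap (insertEverywhere x) (permutations xs) (φ ∘ reverse) ⟩
  ∑ (permutations xs) (∑-insert x (φ ∘ reverse))
    ≡⟨ ∑-cong (permutations xs) (∑-insert-reverse x φ) ⟩
  ∑ (permutations xs) (∑-insert x φ ∘ reverse)
    ≡⟨ ∑-permutations xs (∑-insert x φ) ⟩
  ∑-histories (length xs) xs (∑-insert x φ)
    ≡⟨ ∑-histories-insert (length xs) x xs φ refl ⟩
  ∑-histories (length (x ∷ xs)) (x ∷ xs) φ ∎
  where open ≡-Reasoning

-- Booleans, logarithms and Bernoulli's inequality

T⇒≡true : ∀ {b} → T b → b ≡ true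
T⇒≡true {true} _ = refl

≡true⇒T : ∀ {b} → b ≡ true → T b
≡true⇒T refl = tt

¬T⇒≡false : ∀ {b} → ¬ T b → b ≡ false
¬T⇒≡false {true}  ¬t = ⊥-elim (¬t tt)
¬T⇒≡false {false} ¬t = refl

n<2^[1+⌊log₂n⌋] : ∀ n → n < 2 ^ suc ⌊log₂ n ⌋
n<2^[1+⌊log₂n⌋] n = ≰⇒> λ 2^≤n →
  1+n≰n (subst (_≤ ⌊log₂ n ⌋) (⌊log₂[2^n]⌋≡n (suc ⌊log₂ n ⌋)) (⌊log₂⌋-mono-≤ 2^≤n))

^-distribʳ-* : ∀ g a b → (a * b) ^ g ≡ a ^ g * b ^ g
^-distribʳ-* zero    a b = refl
^-distribʳ-* (suc g) a b = ≡.trans (cong (a * b *_) (^-distribʳ-* g a b)) (interchange a b (a ^ g) (b ^ g))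
  where
  interchange : ∀ a b c d → a * b * (c * d) ≡ a * c * (b * d)
  interchange = solve-∀

-- Bernoulli's inequality 1 - g/s ≤ (1 - 1/s)^g for s = t + 1, cleared of denominators.
bernoulli : ∀ t g → (suc t ∸ g) * suc t ^ g ≤ suc t * t ^ g
bernoulli t zero    = ≤-refl
bernoulli t (suc g) = begin
  (t ∸ g) * (suc t * suc t ^ g)      ≡⟨ *-assoc (t ∸ g) (suc t) _ ⟨
  (t ∸ g) * suc t * suc t ^ g        ≤⟨ *-monoˡ-≤ (suc t ^ g) exchange ⟩
  (suc t ∸ g) * t * suc t ^ g        ≡⟨ shuffle (suc t ∸ g) t (suc t ^ g) ⟩
  t * ((suc t ∸ g) * suc t ^ g)      ≤⟨ *-monoʳ-≤ t (bernoulli t g) ⟩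
  t * (suc t * t ^ g)                ≡⟨ shuffle′ t (suc t) (t ^ g) ⟩
  suc t * (t * t ^ g)                ∎
  where
  open ≤-Reasoning
  shuffle : ∀ a b c → a * b * c ≡ b * (a * c)
  shuffle = solve-∀
  shuffle′ : ∀ a b c → a * (b * c) ≡ b * (a * c)
  shuffle′ = solve-∀
  -- For `g > t` truncated subtraction makes the left side 0; otherwise the two sides differ by
  -- exactly `g`.
  exchange : (t ∸ g) * suc t ≤ (suc t ∸ g) * t
  exchange with g ≤? t
  ... | no  g≰t = subst (λ d → d * suc t ≤ (suc t ∸ g) * t) (sym (m≤n⇒m∸n≡0 (≰⇒≥ g≰t))) z≤n
  ... | yes g≤t = begin
    (t ∸ g) * suc t          ≡⟨ *-suc (t ∸ g) t ⟩
    (t ∸ g) + (t ∸ g) * t    ≤⟨ +-monoˡ-≤ _ (m∸n≤m t g) ⟩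
    t + (t ∸ g) * t          ≡⟨ cong (_* t) (+-∸-assoc 1 g≤t) ⟨
    (suc t ∸ g) * t          ∎

-- Survival probabilities under backward exposure

module Survival
  (m N g : ℕ) (allowed : List A → A → ℕ)
  (allowed-↭ : ∀ {xs ys} a → xs ↭ ys → allowed xs a ≡ allowed ys a)
  (few-allowed : ∀ xs → m < length xs → length xs ≤ N → ∑ xs (allowed xs) ≤ length xs ∸ g)
  where

  -- For a 0/1-valued `allowed` this is the indicator that each arrival preceded by at least `m`
  -- others is allowed at its time; the sample imposes no condition.
  survives : List A → ℕ
  survives []      = 1
  survives (a ∷ ρ) = if m ≤ᵇ length ρ then allowed (a ∷ ρ) a * survives ρ else 1

  survives-∷ : ∀ a ρ → m ≤ length ρ → survives (a ∷ ρ) ≡ allowed (a ∷ ρ) a * survives ρ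
  survives-∷ a ρ m≤ rewrite T⇒≡true (≤⇒≤ᵇ m≤) = refl

  survives-early : ∀ ρ → length ρ ≤ m → survives ρ ≡ 1
  survives-early []      l≤m = refl
  survives-early (a ∷ ρ) l<m with m ≤ᵇ length ρ in eq
  ... | true  = ⊥-elim (<⇒≱ l<m (≤ᵇ⇒≤ m (length ρ) (≡true⇒T eq)))
  ... | false = refl

  private
    -- `allowed xs a` depends only on the set `xs` and its last element, so it factors out of the
    -- sum over the orders of the rest; `few-allowed` bounds the sum of these factors. The pair `c`,
    -- `b` carries the bound for one element less.
    bound-step : ∀ t xs → m ≤ t → length xs ≡ suc t → suc t ≤ N → ∀ c b →
      (∀ r → length r ≡ t → ∑-histories t r survives * c ≤ b) →
      ∑-histories (suc t) xs survives * c ≤ (suc t ∸ g) * b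
    bound-step t xs m≤t l t<N c b IH = begin
      ∑-histories (suc t) xs survives * c
        ≡⟨ ∑-*ʳ c (picks xs) _ ⟨
      ∑ (picks xs) (λ (a , r) → ∑-histories t r (survives ∘ (a ∷_)) * c)
        ≤⟨ ∑-mono-All (All.map (λ {(a , r)} p → last a r (pick-length l p) p) (picks-↭ xs)) ⟩
      ∑ (picks xs) (λ (a , r) → allowed xs a * b)
        ≡⟨ ∑-picks xs (λ a → allowed xs a * b) ⟩
      ∑ xs (λ a → allowed xs a * b)
        ≡⟨ ∑-*ʳ b xs (allowed xs) ⟩
      ∑ xs (allowed xs) * b
        ≤⟨ *-monoˡ-≤ b (few-allowed xs (subst (m <_) (sym l) (s≤s m≤t)) (subst (_≤ N) (sym l) t<N)) ⟩
      (length xs ∸ g) * b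
        ≡⟨ cong (λ k → (k ∸ g) * b) l ⟩
      (suc t ∸ g) * b ∎
      where
      open ≤-Reasoning
      last : ∀ a r → length r ≡ t → a ∷ r ↭ xs →
             ∑-histories t r (survives ∘ (a ∷_)) * c ≤ allowed xs a * b
      last a r lr p = begin
        ∑-histories t r (survives ∘ (a ∷_)) * c
          ≤⟨ *-monoˡ-≤ c (∑-histories-mono t r lr λ ρ q → ≤-reflexive
               (≡.trans (survives-∷ a ρ (subst (m ≤_) (sym (≡.trans (↭-length q) lr)) m≤t))
                      (cong (_* survives ρ) (allowed-↭ a (↭-trans (prep a q) p))))) ⟩
        ∑-histories t r (λ ρ → allowed xs a * survives ρ) * c
          ≡⟨ cong (_* c) (∑-histories-*ˡ (allowed xs a) t r survives) ⟩
        allowed xs a * ∑-histories t r survives * c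
          ≡⟨ *-assoc (allowed xs a) _ c ⟩
        allowed xs a * (∑-histories t r survives * c)
          ≤⟨ *-monoʳ-≤ (allowed xs a) (IH r lr) ⟩
        allowed xs a * b ∎

  -- The probability is at most the product of 1 - g/s over m < s ≤ t. Bernoulli's inequality
  -- replaces each factor by ((s-1)/s)^g, and the product telescopes to (m/t)^g.
  ∑-survives : ∀ t xs → m ≤ t → length xs ≡ t → t ≤ N →
               ∑-histories t xs survives * t ^ g ≤ t ! * m ^ g
  ∑-survives t xs m≤t l t≤N with m≤n⇒m<n∨m≡n m≤t
  ... | inj₂ refl = *-monoˡ-≤ (m ^ g) (begin
    ∑-histories m xs survives   ≤⟨ ∑-histories-mono m xs l (λ ρ q → ≤-reflexive
                                     (survives-early ρ (≤-reflexive (≡.trans (↭-length q) l)))) ⟩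
    ∑-histories m xs (const 1)  ≡⟨ ∑-histories-const m xs 1 l ⟩
    m ! * 1                     ≡⟨ *-identityʳ (m !) ⟩
    m !                         ∎)
    where open ≤-Reasoning
  -- Cancelling `t ^ g` requires a nonzero `t`, so the step from 0 to 1 element, where `m` is 0, is
  -- made directly.
  ∑-survives (suc zero) xs _ l t≤N | inj₁ (s≤s z≤n) = begin
    ∑-histories 1 xs survives * 1 ^ g   ≤⟨ bound-step 0 xs z≤n l t≤N (1 ^ g) (1 ^ g) (λ _ _ → ≤-reflexive (*-identityˡ _)) ⟩
    (1 ∸ g) * 1 ^ g                     ≤⟨ bernoulli 0 g ⟩
    1 * 0 ^ g                           ∎
    where open ≤-Reasoning
  ∑-survives (suc t@(suc _)) xs _ l t≤N | inj₁ (s≤s m≤t) =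
    *-cancelʳ-≤ _ _ (t ^ g) {{m^n≢0 t g}} (begin
      ∑-histories (suc t) xs survives * suc t ^ g * t ^ g
        ≡⟨ swapʳ (∑-histories (suc t) xs survives) (suc t ^ g) (t ^ g) ⟩
      ∑-histories (suc t) xs survives * t ^ g * suc t ^ g
        ≤⟨ *-monoˡ-≤ (suc t ^ g) (bound-step t xs m≤t l t≤N (t ^ g) (t ! * m ^ g)
             (λ r lr → ∑-survives t r m≤t lr (<⇒≤ t≤N))) ⟩
      (suc t ∸ g) * (t ! * m ^ g) * suc t ^ g
        ≡⟨ swapʳ (suc t ∸ g) (t ! * m ^ g) (suc t ^ g) ⟩
      (suc t ∸ g) * suc t ^ g * (t ! * m ^ g)
        ≤⟨ *-monoˡ-≤ (t ! * m ^ g) (bernoulli t g) ⟩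
      suc t * t ^ g * (t ! * m ^ g)
        ≡⟨ regroup (suc t) (t ^ g) (t !) (m ^ g) ⟩
      suc t ! * m ^ g * t ^ g ∎)
    where
    open ≤-Reasoning
    swapʳ : ∀ a b c → a * b * c ≡ a * c * b
    swapʳ = solve-∀
    regroup : ∀ a b c d → a * b * (c * d) ≡ a * c * d * b
    regroup = solve-∀

  ∑-survives-half : ∀ t xs → 0 < t → m + m ≤ t → length xs ≡ t → t ≤ N →
                    ∑-histories t xs survives * 2 ^ g ≤ t !
  ∑-survives-half t xs 0<t 2m≤t l t≤N = *-cancelʳ-≤ _ _ (t ^ g) {{m^n≢0 t g {{>-nonZero 0<t}}}} (begin
    ∑-histories t xs survives * 2 ^ g * t ^ g
      ≡⟨ swapʳ (∑-histories t xs survives) (2 ^ g) (t ^ g) ⟩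
    ∑-histories t xs survives * t ^ g * 2 ^ g
      ≤⟨ *-monoˡ-≤ (2 ^ g) (∑-survives t xs (m+n≤o⇒m≤o m 2m≤t) l t≤N) ⟩
    t ! * m ^ g * 2 ^ g
      ≡⟨ *-assoc (t !) (m ^ g) (2 ^ g) ⟩
    t ! * (m ^ g * 2 ^ g)
      ≡⟨ cong (t ! *_) (^-distribʳ-* g m 2) ⟨
    t ! * (m * 2) ^ g
      ≤⟨ *-monoʳ-≤ (t !) (^-monoˡ-≤ g (subst (_≤ t) (double m) 2m≤t)) ⟩
    t ! * t ^ g ∎)
    where
    open ≤-Reasoning
    swapʳ : ∀ a b c → a * b * c ≡ a * c * b
    swapʳ = solve-∀
    double : ∀ m → m + m ≡ m * 2
    double = solve-∀

-- Sums over all subsets, for the union bound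

subsets : ∀ n → List (Subset n)
subsets zero    = [] ∷ []
subsets (suc n) = map (false ∷_) (subsets n) ++ map (true ∷_) (subsets n)

∑-subsets-suc : ∀ n (f : Subset (suc n) → ℕ) →
  ∑ (subsets (suc n)) f ≡ ∑ (subsets n) (f ∘ (false ∷_)) + ∑ (subsets n) (f ∘ (true ∷_))
∑-subsets-suc n f = ≡.trans (∑-++ (map (false ∷_) (subsets n)) _ f)
  (cong₂ _+_ (∑-map (false ∷_) (subsets n)) (∑-map (true ∷_) (subsets n)))

≤∑-subsets : ∀ {n} (f : Subset n → ℕ) V → f V ≤ ∑ (subsets n) f
≤∑-subsets         f []          = ≤-reflexive (sym (+-identityʳ _))
≤∑-subsets {suc n} f (false ∷ V) = ≤-trans (≤∑-subsets (f ∘ (false ∷_)) V)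
  (≤-trans (m≤m+n _ _) (≤-reflexive (sym (∑-subsets-suc n f))))
≤∑-subsets {suc n} f (true ∷ V)  = ≤-trans (≤∑-subsets (f ∘ (true ∷_)) V)
  (≤-trans (m≤n+m _ _) (≤-reflexive (sym (∑-subsets-suc n f))))

-- The weights c^(-|V|) over all V sum to (1 + 1/c)^n by the binomial theorem; the induction yields
-- one factor 1 + 1/c per item.
∑-subsets-geometric : ∀ n M c (f : Subset n → ℕ) → (∀ V → f V * c ^ ∣ V ∣ ≤ M) →
                      ∑ (subsets n) f * c ^ n ≤ M * suc c ^ n
∑-subsets-geometric zero    M c f f≤ = subst₂ _≤_
  (cong (_* 1) (sym (+-identityʳ (f [])))) (sym (*-identityʳ M)) (f≤ [])
∑-subsets-geometric (suc n) M c f f≤ = begin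
  ∑ (subsets (suc n)) f * (c * c ^ n)
    ≡⟨ cong (_* (c * c ^ n)) (∑-subsets-suc n f) ⟩
  (F₀ + F₁) * (c * c ^ n)
    ≡⟨ split F₀ F₁ c (c ^ n) ⟩
  c * (F₀ * c ^ n) + F₁ * c * c ^ n
    ≡⟨ cong (λ z → c * (F₀ * c ^ n) + z * c ^ n) (∑-*ʳ c (subsets n) (f ∘ (true ∷_))) ⟨
  c * (F₀ * c ^ n) + ∑ (subsets n) (λ V → f (true ∷ V) * c) * c ^ n
    ≤⟨ +-mono-≤ (*-monoʳ-≤ c (∑-subsets-geometric n M c (f ∘ (false ∷_)) (f≤ ∘ (false ∷_))))
                (∑-subsets-geometric n M c (λ V → f (true ∷ V) * c)
                  (λ V → subst (_≤ M) (sym (*-assoc (f (true ∷ V)) c _)) (f≤ (true ∷ V)))) ⟩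
  c * (M * suc c ^ n) + M * suc c ^ n
    ≡⟨ merge c M (suc c ^ n) ⟩
  M * suc c ^ suc n ∎
  where
  open ≤-Reasoning
  F₀ = ∑ (subsets n) (f ∘ (false ∷_))
  F₁ = ∑ (subsets n) (f ∘ (true ∷_))
  split : ∀ a b c d → (a + b) * (c * d) ≡ c * (a * d) + b * c * d
  split = solve-∀
  merge : ∀ c M p → c * (M * p) + M * p ≡ M * (suc c * p)
  merge = solve-∀

[1+c]^n≤2c^n : ∀ n c → 0 < c → n + n ≤ c → suc c ^ n ≤ 2 * c ^ n
[1+c]^n≤2c^n n c 0<c 2n≤c = *-cancelˡ-≤ c {{>-nonZero 0<c}} (begin
  c * suc c ^ n          ≤⟨ linear n 2n≤c ⟩
  (c + (n + n)) * c ^ n  ≤⟨ *-monoˡ-≤ (c ^ n) (+-monoʳ-≤ c 2n≤c) ⟩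
  (c + c) * c ^ n        ≡⟨ double c (c ^ n) ⟩
  c * (2 * c ^ n)        ∎)
  where
  open ≤-Reasoning
  double : ∀ c p → (c + c) * p ≡ c * (2 * p)
  double = solve-∀
  -- The induction carries the linear bound (1 + 1/c)^j ≤ 1 + 2j/c; the excess 2j/c^2 of each step
  -- is absorbed because 2j ≤ c.
  linear : ∀ j → j + j ≤ c → c * suc c ^ j ≤ (c + (j + j)) * c ^ j
  linear zero    _     = ≤-reflexive (cong (_* 1) (sym (+-identityʳ c)))
  linear (suc j) 2j+2≤c = begin
    c * (suc c * suc c ^ j)
      ≡⟨ shuffle c (suc c) (suc c ^ j) ⟩
    suc c * (c * suc c ^ j)
      ≤⟨ *-monoʳ-≤ (suc c) (linear j 2j≤c) ⟩
    suc c * ((c + (j + j)) * c ^ j)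
      ≡⟨ expand c j (c ^ j) ⟩
    (c * c + c + (j + j) * c + (j + j)) * c ^ j
      ≤⟨ *-monoˡ-≤ (c ^ j) (+-monoʳ-≤ (c * c + c + (j + j) * c) 2j≤c) ⟩
    (c * c + c + (j + j) * c + c) * c ^ j
      ≡⟨ collect c j (c ^ j) ⟩
    (c + (suc j + suc j)) * (c * c ^ j) ∎
    where
    2j≤c : j + j ≤ c
    2j≤c = ≤-trans (+-mono-≤ (n≤1+n j) (n≤1+n j)) 2j+2≤c
    shuffle : ∀ a b p → a * (b * p) ≡ b * (a * p)
    shuffle = solve-∀
    expand : ∀ c j p → suc c * ((c + (j + j)) * p) ≡ (c * c + c + (j + j) * c + (j + j)) * p
    expand = solve-∀
    collect : ∀ c j p → (c * c + c + (j + j) * c + c) * p ≡ (c + (suc j + suc j)) * (c * p)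
    collect = solve-∀

-- The algorithm

𝟙 : Bool → ℕ
𝟙 b = if b then 1 else 0

sampleSize : ℕ → ℕ
sampleSize n = ⌊ n /2⌋

-- One unit rounds the logarithm up, so that a power of 2 exceeds n; the other gives the further
-- factor 2 used in `many-good` and in the union bound.
logFactor : ℕ → ℕ
logFactor n = 2 + ⌊log₂ n ⌋

-- Positional form of Ψ below: D marks the items selected so far, and what is
-- counted are the sets T of items of value 1 such that f holds for D ∪ T.
countExtensions : ∀ {k} → Vec ℕ k → Subset k → (Subset k → Bool) → ℕ
countExtensions []       []      f = 𝟙 (f [])
countExtensions (v ∷ vs) (d ∷ D) f =
  -- With `d` true the two counts coincide: a selected item of value 1 may belong to T or not, which
  -- doubles the count.
  countExtensions vs D (f ∘ (d ∷_)) + v * countExtensions vs D (f ∘ (true ∷_))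

-- Appending `false` or `true` to `decisions` encodes W or W ∪ a, so the two counts are Ψ(A, W) and
-- Ψ(A, W ∪ a) for the set A of arrived items.
algorithm : OnlineAlg
algorithm n k values feasible decisions =
  (sampleSize n ≤ᵇ k) ∧
  (countExtensions values (decisions ∷ʳ false) feasible <ᵇ
   2 ^ logFactor n * (Vec.last values * countExtensions values (decisions ∷ʳ true) feasible))

countExtensions-cong : ∀ {k} (vs : Vec ℕ k) D {f g : Subset k → Bool} → (∀ T → f T ≡ g T) →
                       countExtensions vs D f ≡ countExtensions vs D g
countExtensions-cong []       []      f≗g = cong 𝟙 (f≗g [])
countExtensions-cong (v ∷ vs) (d ∷ D) f≗g = cong₂ (λ a b → a + v * b)
  (countExtensions-cong vs D (f≗g ∘ (d ∷_))) (countExtensions-cong vs D (f≗g ∘ (true ∷_)))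

image-∷ʳ : ∀ {n k} (as : Vec (Fin n) k) (bs : Subset k) a b →
           image (as ∷ʳ a) (bs ∷ʳ b) ≡ image as bs ∪ (if b then ⁅ a ⁆ else ⊥)
image-∷ʳ []       []       a b = ∪-comm _ ⊥
image-∷ʳ (c ∷ as) (d ∷ bs) a b =
  ≡.trans (cong ((if d then ⁅ c ⁆ else ⊥) ∪_) (image-∷ʳ as bs a b)) (sym (∪-assoc (if d then ⁅ c ⁆ else ⊥) _ _))

toList-∷ʳ-↭ : ∀ {A : Set} {k} (xs : Vec A k) a → toList (xs ∷ʳ a) ↭ a ∷ toList xs
toList-∷ʳ-↭ []       a = refl
toList-∷ʳ-↭ (x ∷ xs) a = ↭-trans (prep x (toList-∷ʳ-↭ xs a)) (swap x a refl)

∪-swapʳ : ∀ {n} (U V W : Subset n) → (U ∪ V) ∪ W ≡ (U ∪ W) ∪ V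
∪-swapʳ U V W = ≡.trans (∪-assoc U V W) (≡.trans (cong (U ∪_) (∪-comm V W)) (sym (∪-assoc U W V)))

∪-absorbʳ : ∀ {n} (U V : Subset n) → (U ∪ V) ∪ V ≡ U ∪ V
∪-absorbʳ U V = ≡.trans (∪-assoc U V V) (cong (U ∪_) (∪-idem V))

-- The count Ψ and the run as a function of the history

module Run {n : ℕ} (F : Family n) (y : Fin n → ℕ) where

  private
    m = sampleSize n
    q = logFactor n

  -- For y ∈ {0,1}: the number of sets T of items of value 1 in xs with W ∪ T feasible.
  Ψ : List (Fin n) → Subset n → ℕ
  Ψ []       W = 𝟙 (F W)
  Ψ (x ∷ xs) W = Ψ xs W + y x * Ψ xs (W ∪ ⁅ x ⁆)

  -- Makes goodness a condition on the unordered set of arrivals, as backward exposure requires.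
  Ψ-↭ : ∀ {xs zs} W → xs ↭ zs → Ψ xs W ≡ Ψ zs W
  Ψ-↭ W refl         = refl
  Ψ-↭ W (prep x p)   = cong₂ (λ a b → a + y x * b) (Ψ-↭ W p) (Ψ-↭ (W ∪ ⁅ x ⁆) p)
  Ψ-↭ W (trans p p′) = ≡.trans (Ψ-↭ W p) (Ψ-↭ W p′)
  Ψ-↭ W (swap {xs = xs} x z p)
    rewrite Ψ-↭ W p | Ψ-↭ (W ∪ ⁅ z ⁆) p | Ψ-↭ (W ∪ ⁅ x ⁆) p | Ψ-↭ ((W ∪ ⁅ x ⁆) ∪ ⁅ z ⁆) p
          | ∪-swapʳ W ⁅ z ⁆ ⁅ x ⁆
    = exchange (y x) (y z) _ _ _ _
    where
    exchange : ∀ a b A B C D → A + b * B + a * (C + b * D) ≡ A + a * C + b * (B + a * D)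
    exchange = solve-∀

  -- The strict inequality excludes items of value 0 and, for downward-closed `F`, items that make
  -- `W ∪ ⁅ a ⁆` infeasible: the right side is then 0.
  good : List (Fin n) → Subset n → Fin n → Bool
  good xs W a = Ψ xs W <ᵇ 2 ^ q * (y a * Ψ xs (W ∪ ⁅ a ⁆))

  accepts : List (Fin n) → Subset n → Fin n → Bool
  accepts ρ W a = (m ≤ᵇ length ρ) ∧ good (a ∷ ρ) W a

  selected : List (Fin n) → Subset n
  selected []      = ⊥
  selected (a ∷ ρ) = if accepts ρ (selected ρ) a then selected ρ ∪ ⁅ a ⁆ else selected ρ

  good-↭ : ∀ {xs zs} W a → xs ↭ zs → good xs W a ≡ good zs W a
  good-↭ W a p = cong₂ (λ u v → u <ᵇ 2 ^ q * (y a * v)) (Ψ-↭ W p) (Ψ-↭ (W ∪ ⁅ a ⁆) p)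

  -- The general `U` takes up the items already traversed; the test of the algorithm is the case
  -- `U = ⊥`.
  countExtensions≡Ψ : ∀ {k} (xs : Vec (Fin n) k) D U →
    countExtensions (Vec.map y xs) D (λ T → F (U ∪ image xs T)) ≡ Ψ (toList xs) (U ∪ image xs D)
  countExtensions≡Ψ []       []      U = refl
  countExtensions≡Ψ (x ∷ xs) (d ∷ D) U = cong₂ (λ a b → a + y x * b)
    (≡.trans (regroup d) (cong (Ψ (toList xs)) (∪-assoc U _ _)))
    (≡.trans (regroup true) (cong (Ψ (toList xs)) (idempotent d)))
    where
    open ≡-Reasoning
    I = image xs D
    regroup : ∀ b → countExtensions (Vec.map y xs) D (λ T → F (U ∪ image (x ∷ xs) (b ∷ T))) ≡
                    Ψ (toList xs) ((U ∪ (if b then ⁅ x ⁆ else ⊥)) ∪ I)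
    regroup b = ≡.trans (countExtensions-cong (Vec.map y xs) D (λ T → cong F (sym (∪-assoc U _ (image xs T)))))
                        (countExtensions≡Ψ xs D _)
    idempotent : ∀ b → (U ∪ ⁅ x ⁆) ∪ I ≡ (U ∪ ((if b then ⁅ x ⁆ else ⊥) ∪ I)) ∪ ⁅ x ⁆
    idempotent false = begin
      (U ∪ ⁅ x ⁆) ∪ I        ≡⟨ ∪-swapʳ U ⁅ x ⁆ I ⟩
      (U ∪ I) ∪ ⁅ x ⁆        ≡⟨ cong (λ z → (U ∪ z) ∪ ⁅ x ⁆) (∪-identityˡ I) ⟨
      (U ∪ (⊥ ∪ I)) ∪ ⁅ x ⁆  ∎
    idempotent true = begin
      (U ∪ ⁅ x ⁆) ∪ I              ≡⟨ cong (_∪ I) (∪-absorbʳ U ⁅ x ⁆) ⟨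
      ((U ∪ ⁅ x ⁆) ∪ ⁅ x ⁆) ∪ I    ≡⟨ ∪-swapʳ (U ∪ ⁅ x ⁆) ⁅ x ⁆ I ⟩
      ((U ∪ ⁅ x ⁆) ∪ I) ∪ ⁅ x ⁆    ≡⟨ cong (_∪ ⁅ x ⁆) (∪-assoc U ⁅ x ⁆ I) ⟩
      (U ∪ (⁅ x ⁆ ∪ I)) ∪ ⁅ x ⁆    ∎

  module _ (down : DownwardClosed F) where

    F-∪ˡ : ∀ U V → F (U ∪ V) ≡ true → F U ≡ true
    F-∪ˡ U V = down U (U ∪ V) (p⊆p∪q V)

    -- A positive count provides some feasible W ∪ T, of which W is a subset.
    Ψ>0⇒F : ∀ xs W → 0 < Ψ xs W → F W ≡ true
    Ψ>0⇒F []       W 0<Ψ with F W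
    ... | true = refl
    Ψ>0⇒F (x ∷ xs) W 0<Ψ with Ψ xs W in eq
    ... | suc _ = Ψ>0⇒F xs W (subst (0 <_) (sym eq) (s≤s z≤n))
    ... | zero with Ψ xs (W ∪ ⁅ x ⁆) in eq′
    ...   | suc _ = F-∪ˡ W ⁅ x ⁆ (Ψ>0⇒F xs (W ∪ ⁅ x ⁆) (subst (0 <_) (sym eq′) (s≤s z≤n)))
    ...   | zero  = ⊥-elim (<-irrefl (sym (*-zeroʳ (y x))) 0<Ψ)

    good⇒< : ∀ xs W a → good xs W a ≡ true → Ψ xs W < 2 ^ q * (y a * Ψ xs (W ∪ ⁅ a ⁆))
    good⇒< xs W a eq = <ᵇ⇒< (Ψ xs W) _ (≡true⇒T eq)

    good⇒F : ∀ xs W a → good xs W a ≡ true → F (W ∪ ⁅ a ⁆) ≡ true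
    good⇒F xs W a eq with Ψ xs (W ∪ ⁅ a ⁆) in eq′
    ... | suc _ = Ψ>0⇒F xs (W ∪ ⁅ a ⁆) (subst (0 <_) (sym eq′) (s≤s z≤n))
    ... | zero  = ⊥-elim (n≮0 (subst (Ψ xs W <_)
      (≡.trans (cong (2 ^ q *_) (*-zeroʳ (y a))) (*-zeroʳ (2 ^ q))) (<ᵇ⇒< (Ψ xs W) _ (≡true⇒T eq))))

    -- By `good⇒F` the test implies the feasibility check of `run`, so the decision is `accepts`, a
    -- function of the history.
    run-step : ∀ {k} (arrived : Vec (Fin n) k) decisions ρ a → toList arrived ↭ ρ →
      image arrived decisions ≡ selected ρ →
      algorithm n k (Vec.map y (arrived ∷ʳ a)) (λ T → F (image (arrived ∷ʳ a) T)) decisions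
        ∧ F (selected ρ ∪ ⁅ a ⁆)
      ≡ accepts ρ (selected ρ) a
    run-step {k} arrived decisions ρ a p im = begin
      algorithm n k (Vec.map y arrived′) (λ T → F (image arrived′ T)) decisions ∧ F (W ∪ ⁅ a ⁆)
        ≡⟨ cong (_∧ F (W ∪ ⁅ a ⁆)) (cong₂ (λ l b → (m ≤ᵇ l) ∧ b) k≡length test) ⟩
      accepts ρ W a ∧ F (W ∪ ⁅ a ⁆)
        ≡⟨ ∧-assoc (m ≤ᵇ length ρ) _ _ ⟩
      (m ≤ᵇ length ρ) ∧ (good (a ∷ ρ) W a ∧ F (W ∪ ⁅ a ⁆))
        ≡⟨ cong ((m ≤ᵇ length ρ) ∧_) feasible ⟩
      accepts ρ W a ∎
      where
      open ≡-Reasoning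
      W = selected ρ
      arrived′ = arrived ∷ʳ a
      k≡length : k ≡ length ρ
      k≡length = ≡.trans (sym (length-toList arrived)) (↭-length p)
      p′ : toList arrived′ ↭ a ∷ ρ
      p′ = ↭-trans (toList-∷ʳ-↭ arrived a) (prep a p)
      count : ∀ b → countExtensions (Vec.map y arrived′) (decisions ∷ʳ b) (λ T → F (image arrived′ T)) ≡
                    Ψ (a ∷ ρ) (W ∪ (if b then ⁅ a ⁆ else ⊥))
      count b = begin
        countExtensions (Vec.map y arrived′) (decisions ∷ʳ b) (λ T → F (image arrived′ T))
          ≡⟨ countExtensions-cong (Vec.map y arrived′) (decisions ∷ʳ b)
               (λ T → cong F (sym (∪-identityˡ (image arrived′ T)))) ⟩
        countExtensions (Vec.map y arrived′) (decisions ∷ʳ b) (λ T → F (⊥ ∪ image arrived′ T))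
          ≡⟨ countExtensions≡Ψ arrived′ (decisions ∷ʳ b) ⊥ ⟩
        Ψ (toList arrived′) (⊥ ∪ image arrived′ (decisions ∷ʳ b))
          ≡⟨ Ψ-↭ _ p′ ⟩
        Ψ (a ∷ ρ) (⊥ ∪ image arrived′ (decisions ∷ʳ b))
          ≡⟨ cong (Ψ (a ∷ ρ)) (≡.trans (∪-identityˡ _) (≡.trans (image-∷ʳ arrived decisions a b) (cong (_∪ _) im))) ⟩
        Ψ (a ∷ ρ) (W ∪ (if b then ⁅ a ⁆ else ⊥)) ∎
      test : (countExtensions (Vec.map y arrived′) (decisions ∷ʳ false) (λ T → F (image arrived′ T)) <ᵇ
              2 ^ q * (Vec.last (Vec.map y arrived′) *
                countExtensions (Vec.map y arrived′) (decisions ∷ʳ true) (λ T → F (image arrived′ T))))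
             ≡ good (a ∷ ρ) W a
      test = cong₂ _<ᵇ_ (≡.trans (count false) (cong (Ψ (a ∷ ρ)) (∪-identityʳ W)))
        (cong (2 ^ q *_) (cong₂ _*_ (≡.trans (cong Vec.last (map-∷ʳ y a arrived)) (last-∷ʳ (y a) (Vec.map y arrived)))
                                    (count true)))
      feasible : good (a ∷ ρ) W a ∧ F (W ∪ ⁅ a ⁆) ≡ good (a ∷ ρ) W a
      feasible with good (a ∷ ρ) W a in eq
      ... | true  = good⇒F (a ∷ ρ) W a eq
      ... | false = refl

    -- The arrival vector, oldest first, and the history, newest first, are linked only up to
    -- permutation; this suffices because Ψ ignores the order.
    run≡selected : ∀ {k} (arrived : Vec (Fin n) k) decisions ρ order → toList arrived ↭ ρ →
      image arrived decisions ≡ selected ρ →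
      run algorithm y F k arrived decisions (selected ρ) order ≡ setValue y (selected (order ʳ++ ρ))
    run≡selected arrived decisions ρ []          p im = refl
    run≡selected {k} arrived decisions ρ (a ∷ order) p im = ≡.trans
      (cong (λ b → run algorithm y F (suc k) (arrived ∷ʳ a) (decisions ∷ʳ b)
                     (if b then selected ρ ∪ ⁅ a ⁆ else selected ρ) order)
            (run-step arrived decisions ρ a p im))
      (run≡selected (arrived ∷ʳ a) (decisions ∷ʳ accepts ρ (selected ρ) a) (a ∷ ρ) order
        (↭-trans (toList-∷ʳ-↭ arrived a) (prep a p))
        (≡.trans (image-∷ʳ arrived decisions a _)
          (≡.trans (cong (_∪ _) im) (branch (accepts ρ (selected ρ) a)))))
      where
      branch : ∀ b → selected ρ ∪ (if b then ⁅ a ⁆ else ⊥) ≡ (if b then selected ρ ∪ ⁅ a ⁆ else selected ρ)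
      branch true  = refl
      branch false = ∪-identityʳ (selected ρ)

    algValue≡selected : ∀ order → algValue algorithm y F order ≡ setValue y (selected (reverse order))
    algValue≡selected order = run≡selected [] [] [] order refl refl

  Ψ-≤-∷ : ∀ x xs W → Ψ xs W ≤ Ψ (x ∷ xs) W
  Ψ-≤-∷ x xs W = m≤m+n (Ψ xs W) _

  -- Many feasible extensions force many good items

  module _ (y≤1 : ∀ i → y i ≤ 1) where

    -- Sets of items all satisfying P are counted by the power of 2; every other
    -- set contains some i with P i false.
    Ψ-≤ : (P : Fin n → Bool) → ∀ xs W →
      Ψ xs W ≤ 2 ^ ∑ xs (𝟙 ∘ P) + ∑ xs (λ i → if P i then 0 else y i * Ψ xs (W ∪ ⁅ i ⁆))
    Ψ-≤ P [] W with F W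
    ... | true  = ≤-refl
    ... | false = z≤n
    Ψ-≤ P (x ∷ xs) W with P x
    ... | false = begin
      Ψ xs W + y x * Ψ xs (W ∪ ⁅ x ⁆)
        -- Every set that contains `x` is charged to the term of `x` itself.
        ≤⟨ +-mono-≤ (Ψ-≤ P xs W) (*-monoʳ-≤ (y x) (Ψ-≤-∷ x xs (W ∪ ⁅ x ⁆))) ⟩
      2 ^ ∑ xs (𝟙 ∘ P) + ∑ xs (λ i → if P i then 0 else y i * Ψ xs (W ∪ ⁅ i ⁆)) + y x * Ψ (x ∷ xs) (W ∪ ⁅ x ⁆)
        ≤⟨ +-monoˡ-≤ _ (+-monoʳ-≤ (2 ^ ∑ xs (𝟙 ∘ P)) (∑-mono xs grow)) ⟩
      2 ^ ∑ xs (𝟙 ∘ P) + ∑ xs (λ i → if P i then 0 else y i * Ψ (x ∷ xs) (W ∪ ⁅ i ⁆)) + y x * Ψ (x ∷ xs) (W ∪ ⁅ x ⁆)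
        ≡⟨ rotate (2 ^ ∑ xs (𝟙 ∘ P)) _ _ ⟩
      2 ^ ∑ xs (𝟙 ∘ P) + (y x * Ψ (x ∷ xs) (W ∪ ⁅ x ⁆) + ∑ xs (λ i → if P i then 0 else y i * Ψ (x ∷ xs) (W ∪ ⁅ i ⁆))) ∎
      where
      open ≤-Reasoning
      rotate : ∀ a b c → a + b + c ≡ a + (c + b)
      rotate = solve-∀
      grow : ∀ i → (if P i then 0 else y i * Ψ xs (W ∪ ⁅ i ⁆)) ≤ (if P i then 0 else y i * Ψ (x ∷ xs) (W ∪ ⁅ i ⁆))
      grow i with P i
      ... | true  = z≤n
      ... | false = *-monoʳ-≤ (y i) (Ψ-≤-∷ x xs (W ∪ ⁅ i ⁆))
    ... | true = begin
      Ψ xs W + y x * Ψ xs (W ∪ ⁅ x ⁆)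
        -- Sets with `x` are split by the induction hypothesis at `W ∪ ⁅ x ⁆`, which doubles the
        -- power of 2.
        ≤⟨ +-mono-≤ (Ψ-≤ P xs W) (*-monoʳ-≤ (y x) (Ψ-≤ P xs (W ∪ ⁅ x ⁆))) ⟩
      p + ∑ xs f + y x * (p + ∑ xs g)
        ≡⟨ cong (p + ∑ xs f +_) (*-distribˡ-+ (y x) p (∑ xs g)) ⟩
      p + ∑ xs f + (y x * p + y x * ∑ xs g)
        ≤⟨ +-monoʳ-≤ (p + ∑ xs f) (+-monoˡ-≤ (y x * ∑ xs g) (*-monoˡ-≤ p (y≤1 x))) ⟩
      p + ∑ xs f + (1 * p + y x * ∑ xs g)
        ≡⟨ regroup p (∑ xs f) (y x * ∑ xs g) ⟩
      2 * p + (∑ xs f + y x * ∑ xs g)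
        ≡⟨ cong (λ z → 2 * p + (∑ xs f + z)) (∑-*ˡ (y x) xs g) ⟨
      2 * p + (∑ xs f + ∑ xs (λ i → y x * g i))
        ≡⟨ cong (2 * p +_) (∑-+ xs f (λ i → y x * g i)) ⟨
      2 * p + ∑ xs (λ i → f i + y x * g i)
        ≡⟨ cong (2 * p +_) (∑-cong xs combine) ⟩
      2 * p + ∑ xs (λ i → if P i then 0 else y i * Ψ (x ∷ xs) (W ∪ ⁅ i ⁆)) ∎
      where
      open ≤-Reasoning
      p = 2 ^ ∑ xs (𝟙 ∘ P)
      f g : Fin n → ℕ
      f i = if P i then 0 else y i * Ψ xs (W ∪ ⁅ i ⁆)
      g i = if P i then 0 else y i * Ψ xs ((W ∪ ⁅ x ⁆) ∪ ⁅ i ⁆)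
      regroup : ∀ p a b → p + a + (1 * p + b) ≡ 2 * p + (a + b)
      regroup = solve-∀
      distrib : ∀ a b c d → b * c + a * (b * d) ≡ b * (c + a * d)
      distrib = solve-∀
      combine : ∀ i → f i + y x * g i ≡ (if P i then 0 else y i * Ψ (x ∷ xs) (W ∪ ⁅ i ⁆))
      combine i with P i
      ... | true  = *-zeroʳ (y x)
      ... | false = ≡.trans (distrib (y x) (y i) _ _)
        (cong (λ Z → y i * (Ψ xs (W ∪ ⁅ i ⁆) + y x * Ψ xs Z)) (∪-swapʳ W ⁅ x ⁆ ⁅ i ⁆))

    -- With c < h good items, at most 2^c ≤ Ψ/2 sets consist of good items alone. Each of the at
    -- most n other items lies in at most Ψ/2^q sets, together fewer than Ψ/2, so not all of Ψ would
    -- be counted.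
    many-good : ∀ h xs W → length xs ≤ n → 2 ^ h ≤ Ψ xs W → h ≤ ∑ xs (𝟙 ∘ good xs W)
    many-good h xs W l≤n 2^h≤Ψ = ≮⇒≥ λ c<h → <⇒≱ (Ψ<ΨL) (few c<h)
      where
      open ≤-Reasoning
      L = suc ⌊log₂ n ⌋
      c = ∑ xs (𝟙 ∘ good xs W)
      Ψ₀ = Ψ xs W
      rest = ∑ xs (λ i → if good xs W i then 0 else y i * Ψ xs (W ∪ ⁅ i ⁆))
      Ψ<ΨL : length xs * Ψ₀ < 2 ^ L * Ψ₀
      Ψ<ΨL = *-monoˡ-< Ψ₀ {{>-nonZero (<-≤-trans (m^n>0 2 h) 2^h≤Ψ)}} (≤-<-trans l≤n (n<2^[1+⌊log₂n⌋] n))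
      bad-small : 2 ^ q * rest ≤ length xs * Ψ₀
      bad-small = begin
        2 ^ q * rest
          ≡⟨ ∑-*ˡ (2 ^ q) xs _ ⟨
        ∑ xs (λ i → 2 ^ q * (if good xs W i then 0 else y i * Ψ xs (W ∪ ⁅ i ⁆)))
          ≤⟨ ∑-mono xs small ⟩
        ∑ xs (const Ψ₀)
          ≡⟨ ∑-const Ψ₀ xs ⟩
        length xs * Ψ₀ ∎
        where
        small : ∀ i → 2 ^ q * (if good xs W i then 0 else y i * Ψ xs (W ∪ ⁅ i ⁆)) ≤ Ψ₀
        small i with good xs W i in eq
        ... | true  = ≤-trans (≤-reflexive (*-zeroʳ (2 ^ q))) z≤n
        ... | false = ≮⇒≥ λ Ψ< → subst T eq (<⇒<ᵇ Ψ<)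
      few : c < h → 2 ^ L * Ψ₀ ≤ length xs * Ψ₀
      few c<h = +-cancelˡ-≤ (2 ^ L * Ψ₀) _ _ (begin
        2 ^ L * Ψ₀ + 2 ^ L * Ψ₀
          ≡⟨ double (2 ^ L) Ψ₀ ⟩
        2 ^ q * Ψ₀
          ≤⟨ *-monoʳ-≤ (2 ^ q) (Ψ-≤ (good xs W) xs W) ⟩
        2 ^ q * (2 ^ c + rest)
          ≡⟨ *-distribˡ-+ (2 ^ q) (2 ^ c) rest ⟩
        2 ^ q * 2 ^ c + 2 ^ q * rest
          ≡⟨ cong (_+ 2 ^ q * rest) (shift (2 ^ L) (2 ^ c)) ⟩
        2 ^ L * 2 ^ suc c + 2 ^ q * rest
          ≤⟨ +-mono-≤ (*-monoʳ-≤ (2 ^ L) (≤-trans (^-monoʳ-≤ 2 c<h) 2^h≤Ψ)) bad-small ⟩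
        2 ^ L * Ψ₀ + length xs * Ψ₀ ∎)
        where
        double : ∀ l p → l * p + l * p ≡ 2 * l * p
        double = solve-∀
        shift : ∀ l p → 2 * l * p ≡ l * (2 * p)
        shift = solve-∀

-- Subsets as sums over items, and restriction to arrived items

∑-allFin : ∀ n (f : Fin n → ℕ) → ∑ (allFin n) f ≡ sum (tabulate f)
∑-allFin n f = cong sum (map-tabulate (λ i → i) f)

setValue≡∑ : ∀ {n} (y : Fin n → ℕ) S → setValue y S ≡ ∑ (allFin n) (λ i → if lookup S i then y i else 0)
setValue≡∑ {n} y S = ≡.trans (foldr-tabulate n _) (sym (∑-allFin n _))
  where
  foldr-tabulate : ∀ n (f : Fin n → ℕ) → Vec.foldr _ _+_ 0 (Vec.tabulate f) ≡ sum (tabulate f)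
  foldr-tabulate zero    f = refl
  foldr-tabulate (suc n) f = cong (f zero +_) (foldr-tabulate n (f ∘ suc))

∣∣≡∑ : ∀ {n} (V : Subset n) → ∣ V ∣ ≡ ∑ (allFin n) (𝟙 ∘ lookup V)
∣∣≡∑ {n} V = ≡.trans (go V) (sym (∑-allFin n _))
  where
  go : ∀ {n} (V : Subset n) → ∣ V ∣ ≡ sum (tabulate (𝟙 ∘ lookup V))
  go []          = refl
  go (true ∷ V)  = cong suc (go V)
  go (false ∷ V) = go V

lookup-⊥ : ∀ {n} (i : Fin n) → lookup ⊥ i ≡ false
lookup-⊥ i = lookup-replicate i false

lookup-∪⁅⁆-same : ∀ {n} (W : Subset n) a → lookup (W ∪ ⁅ a ⁆) a ≡ true
lookup-∪⁅⁆-same W a = []=⇒lookup (q⊆p∪q W ⁅ a ⁆ (x∈⁅x⁆ a))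

lookup-∪⁅⁆-other : ∀ {n} (W : Subset n) {a x} → x ≢ a → lookup (W ∪ ⁅ a ⁆) x ≡ lookup W x
lookup-∪⁅⁆-other W {a} {x} x≢a = begin
  lookup (W ∪ ⁅ a ⁆) x         ≡⟨ lookup-zipWith _∨_ x W ⁅ a ⁆ ⟩
  lookup W x ∨ lookup ⁅ a ⁆ x  ≡⟨ cong (lookup W x ∨_) (¬T⇒≡false
                                    (λ t → x≢y⇒x∉⁅y⁆ x≢a (lookup⇒[]= x ⁅ a ⁆ (T⇒≡true t)))) ⟩
  lookup W x ∨ false           ≡⟨ ∨-identityʳ _ ⟩
  lookup W x                   ∎
  where open ≡-Reasoning

-- V ∩ A, built by the same recursion as `selected` so that the two can be matched arrival by
-- arrival.
restrict : ∀ {n} → Subset n → List (Fin n) → Subset n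
restrict V []       = ⊥
restrict V (a ∷ xs) = if lookup V a then restrict V xs ∪ ⁅ a ⁆ else restrict V xs

restrict-↭ : ∀ {n} (V : Subset n) {xs zs} → xs ↭ zs → restrict V xs ≡ restrict V zs
restrict-↭ V refl         = refl
restrict-↭ V (prep a p)   = cong (λ R → if lookup V a then R ∪ ⁅ a ⁆ else R) (restrict-↭ V p)
restrict-↭ V (trans p p′) = ≡.trans (restrict-↭ V p) (restrict-↭ V p′)
restrict-↭ V (swap a b p) rewrite restrict-↭ V p with lookup V a | lookup V b
... | true  | true  = ∪-swapʳ _ ⁅ b ⁆ ⁅ a ⁆
... | true  | false = refl
... | false | true  = refl
... | false | false = refl

-- Orders with a prescribed final selection

module Analysis {n : ℕ} (F : Family n) (y : Fin n → ℕ)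
  (down : DownwardClosed F) (y≤1 : ∀ i → y i ≤ 1) where

  open Run F y

  private
    m = sampleSize n
    q = logFactor n

  accepted : List (Fin n) → ℕ
  accepted []      = 0
  accepted (a ∷ ρ) = 𝟙 (accepts ρ (selected ρ) a) + accepted ρ

  selected-∉ : ∀ ρ {x} → x ∉ ρ → lookup (selected ρ) x ≡ false
  selected-∉ []      {x} _ = lookup-⊥ x
  selected-∉ (a ∷ ρ) {x} x∉ with accepts ρ (selected ρ) a
  ... | true  = ≡.trans (lookup-∪⁅⁆-other (selected ρ) (x∉ ∘ here)) (selected-∉ ρ (x∉ ∘ there))
  ... | false = selected-∉ ρ (x∉ ∘ there)

  -- Only arrived items are compared, so that one fixed `V` can agree with the selection at all
  -- earlier times.
  Agree : Subset n → List (Fin n) → Set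
  Agree V ρ = ∀ {x} → x ∈ ρ → lookup V x ≡ lookup (selected ρ) x

  ∉-head : ∀ {a : Fin n} {ρ} → Unique (a ∷ ρ) → a ∉ ρ
  ∉-head (a≢ ∷ _) a∈ = All.lookup a≢ a∈ refl

  -- Without repetitions `a` cannot be selected before it arrives, so its membership records the
  -- decision taken on its arrival.
  agree-head : ∀ V a ρ → Unique (a ∷ ρ) → Agree V (a ∷ ρ) → lookup V a ≡ accepts ρ (selected ρ) a
  agree-head V a ρ u agree with accepts ρ (selected ρ) a | agree (here refl)
  ... | true  | eq = ≡.trans eq (lookup-∪⁅⁆-same (selected ρ) a)
  ... | false | eq = ≡.trans eq (selected-∉ ρ (∉-head u))

  agree-tail : ∀ V a ρ → Unique (a ∷ ρ) → Agree V (a ∷ ρ) → Agree V ρ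
  agree-tail V a ρ u agree {x} x∈ρ with accepts ρ (selected ρ) a | agree (there x∈ρ)
  ... | true  | eq = ≡.trans eq (lookup-∪⁅⁆-other (selected ρ) λ { refl → ∉-head u x∈ρ })
  ... | false | eq = eq

  agree⇒restrict : ∀ V ρ → Unique ρ → Agree V ρ → restrict V ρ ≡ selected ρ
  agree⇒restrict V []      u         agree = refl
  agree⇒restrict V (a ∷ ρ) u@(_ ∷ u′) agree =
    cong₂ (λ b R → if b then R ∪ ⁅ a ⁆ else R) (agree-head V a ρ u agree)
          (agree⇒restrict V ρ u′ (agree-tail V a ρ u agree))

  agree⇒count : ∀ V ρ → Unique ρ → Agree V ρ → ∑ ρ (𝟙 ∘ lookup V) ≡ accepted ρ
  agree⇒count V []      u          agree = refl
  agree⇒count V (a ∷ ρ) u@(_ ∷ u′) agree =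
    cong₂ (λ b k → 𝟙 b + k) (agree-head V a ρ u agree)
          (agree⇒count V ρ u′ (agree-tail V a ρ u agree))

  good⇒value : ∀ xs W a → good xs W a ≡ true → 1 ≤ y a
  good⇒value xs W a eq with y a | good⇒< down xs W a eq
  ... | suc _ | _  = s≤s z≤n
  ... | zero  | Ψ< = ⊥-elim (n≮0 (subst (Ψ xs W <_) (*-zeroʳ (2 ^ q)) Ψ<))

  accepts⇒good : ∀ ρ W a → accepts ρ W a ≡ true → good (a ∷ ρ) W a ≡ true
  accepts⇒good ρ W a eq with m ≤ᵇ length ρ
  ... | true  = eq

  accepts-late : ∀ ρ W a → m ≤ length ρ → accepts ρ W a ≡ good (a ∷ ρ) W a
  accepts-late ρ W a m≤ = cong (_∧ good (a ∷ ρ) W a) (T⇒≡true (≤⇒≤ᵇ m≤))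

  accepts-early : ∀ ρ W a → length ρ < m → accepts ρ W a ≡ false
  accepts-early ρ W a <m = cong (_∧ good (a ∷ ρ) W a) (¬T⇒≡false λ t → <⇒≱ <m (≤ᵇ⇒≤ m (length ρ) t))

  -- Accepted items are good and hence have value at least 1. `V` stays fixed while the history
  -- shrinks.
  agree⇒accepted≤value : ∀ V ρ → Unique ρ → Agree V ρ →
    accepted ρ ≤ ∑ ρ (λ i → if lookup V i then y i else 0)
  agree⇒accepted≤value V []      u          agree = z≤n
  agree⇒accepted≤value V (a ∷ ρ) u@(_ ∷ u′) agree =
    +-mono-≤ (head (agree-head V a ρ u agree)) (agree⇒accepted≤value V ρ u′ (agree-tail V a ρ u agree))
    where
    head : ∀ {b} → b ≡ accepts ρ (selected ρ) a →
           𝟙 (accepts ρ (selected ρ) a) ≤ (if b then y a else 0)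
    head refl with accepts ρ (selected ρ) a in eq
    ... | true  = good⇒value (a ∷ ρ) (selected ρ) a (accepts⇒good ρ (selected ρ) a eq)
    ... | false = z≤n

  unique-order : ∀ {ρ} → ρ ↭ allFin n → Unique ρ
  unique-order p = Unique-resp-↭ (setoid (Fin n)) (↭⇒↭ₛ (↭-sym p)) (allFin⁺ n)

  accepted≤setValue : ∀ ρ → ρ ↭ allFin n → accepted ρ ≤ setValue y (selected ρ)
  accepted≤setValue ρ p = begin
    accepted ρ
      ≤⟨ agree⇒accepted≤value (selected ρ) ρ (unique-order p) (λ _ → refl) ⟩
    ∑ ρ (λ i → if lookup (selected ρ) i then y i else 0)
      ≡⟨ ∑-↭ _ p ⟩
    ∑ (allFin n) (λ i → if lookup (selected ρ) i then y i else 0)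
      ≡⟨ setValue≡∑ y (selected ρ) ⟨
    setValue y (selected ρ) ∎
    where open ≤-Reasoning

  ∣selected∣ : ∀ ρ → ρ ↭ allFin n → ∣ selected ρ ∣ ≡ accepted ρ
  ∣selected∣ ρ p = ≡.trans (∣∣≡∑ (selected ρ))
    (≡.trans (∑-↭ _ (↭-sym p)) (agree⇒count (selected ρ) ρ (unique-order p) (λ _ → refl)))

  length-allFin : length (allFin n) ≡ n
  length-allFin = length-tabulate (λ i → i)

  ∑accepted : ℕ
  ∑accepted = ∑-histories n (allFin n) accepted

  ∑accepted≤totalAlgValue : ∑accepted ≤ totalAlgValue algorithm y F
  ∑accepted≤totalAlgValue = begin
    ∑-histories n (allFin n) accepted
      ≤⟨ ∑-histories-mono n (allFin n) length-allFin accepted≤setValue ⟩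
    ∑-histories n (allFin n) (setValue y ∘ selected)
      ≡⟨ cong (λ l → ∑-histories l (allFin n) (setValue y ∘ selected)) length-allFin ⟨
    ∑-histories (length (allFin n)) (allFin n) (setValue y ∘ selected)
      ≡⟨ ∑-permutations (allFin n) (setValue y ∘ selected) ⟨
    ∑ (arrivalOrders n) (setValue y ∘ selected ∘ reverse)
      ≡⟨ ∑-cong (arrivalOrders n) (algValue≡selected down) ⟨
    totalAlgValue algorithm y F ∎
    where open ≤-Reasoning

  -- An order along which the algorithm selects exactly V survives `allowed g V`
  -- as long as Ψ stays large: an item outside V must not be good on arrival.
  allowed : ℕ → Subset n → List (Fin n) → Fin n → ℕ
  allowed g V xs a = 𝟙 ((2 ^ (g + ∑ xs (𝟙 ∘ lookup V)) ≤ᵇ Ψ xs (restrict V xs)) ∧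
                        (lookup V a ∨ not (good xs (restrict V xs) a)))

  allowed-↭ : ∀ g V {xs zs} a → xs ↭ zs → allowed g V xs a ≡ allowed g V zs a
  allowed-↭ g V {xs} {zs} a p = cong 𝟙 (cong₂ _∧_
    (cong₂ (λ c v → 2 ^ (g + c) ≤ᵇ v) (∑-↭ (𝟙 ∘ lookup V) p)
           (≡.trans (cong (Ψ xs) (restrict-↭ V p)) (Ψ-↭ (restrict V zs) p)))
    (cong (λ b → lookup V a ∨ not b)
          (≡.trans (cong (λ R → good xs R a) (restrict-↭ V p)) (good-↭ (restrict V zs) a p))))

  -- If the size test fails, nothing is allowed. Otherwise `many-good` gives g + |V ∩ A| good items,
  -- of which at least g lie outside V and are forbidden.
  few-allowed : ∀ g V xs → length xs ≤ n → ∑ xs (allowed g V xs) ≤ length xs ∸ g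
  few-allowed g V xs l≤n with 2 ^ (g + ∑ xs (𝟙 ∘ lookup V)) ≤ᵇ Ψ xs (restrict V xs) in eq
  ... | false = ≤-trans (≤-reflexive (∑-zero xs)) z≤n
  ... | true  = m+n≤o⇒m≤o∸n s (+-cancelʳ-≤ c (s + g) (length xs) (begin
    s + g + c
      ≡⟨ +-assoc s g c ⟩
    s + (g + c)
      ≤⟨ +-monoʳ-≤ s (many-good y≤1 (g + c) xs R l≤n (≤ᵇ⇒≤ _ _ (≡true⇒T eq))) ⟩
    s + ∑ xs (𝟙 ∘ good xs R)
      ≡⟨ ∑-+ xs _ _ ⟨
    ∑ xs (λ a → 𝟙 (lookup V a ∨ not (good xs R a)) + 𝟙 (good xs R a))
      ≤⟨ ∑-mono xs pointwise ⟩
    ∑ xs (λ a → 1 + 𝟙 (lookup V a))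
      ≡⟨ ∑-+ xs (const 1) _ ⟩
    ∑ xs (const 1) + c
      ≡⟨ cong (_+ c) (≡.trans (∑-const 1 xs) (*-identityʳ (length xs))) ⟩
    length xs + c ∎))
    where
    open ≤-Reasoning
    R = restrict V xs
    c = ∑ xs (𝟙 ∘ lookup V)
    s = ∑ xs (λ a → 𝟙 (lookup V a ∨ not (good xs R a)))
    pointwise : ∀ a → 𝟙 (lookup V a ∨ not (good xs R a)) + 𝟙 (good xs R a) ≤ 1 + 𝟙 (lookup V a)
    pointwise a with lookup V a | good xs R a
    ... | true  | true  = ≤-refl
    ... | true  | false = s≤s z≤n
    ... | false | true  = ≤-refl
    ... | false | false = ≤-refl

  module Event (g : ℕ) (V : Subset n) =
    Survival m n g (allowed g V) (allowed-↭ g V) (λ xs _ → few-allowed g V xs)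

  -- At most half of the items are sampled, so (m/n)^g ≤ 2^-g.
  ∑-event : ∀ g V → 0 < n → ∑-histories n (allFin n) (Event.survives g V) * 2 ^ g ≤ n !
  ∑-event g V 0<n = Event.∑-survives-half g V n (allFin n) 0<n 2m≤n length-allFin ≤-refl
    where
    2m≤n : m + m ≤ n
    2m≤n = ≤-trans (+-monoʳ-≤ m (⌊n/2⌋≤⌈n/2⌉ n)) (≤-reflexive (⌊n/2⌋+⌈n/2⌉≡n n))

  -- `Q` is an invariant that passes to earlier histories down to the end of the sample and keeps Ψ
  -- large; it is instantiated with `Idle` and with `Stuck`.
  agree⇒survives : ∀ g V (Q : List (Fin n) → Set) →
    (∀ a ρ → m ≤ length ρ → Q (a ∷ ρ) → Q ρ) →
    (∀ ρ → Q ρ → 2 ^ (g + accepted ρ) ≤ Ψ ρ (selected ρ)) →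
    ∀ ρ → Unique ρ → Agree V ρ → Q ρ → 1 ≤ Event.survives g V ρ
  agree⇒survives g V Q Q-tail Q-large []      u          agree Qρ = ≤-refl
  agree⇒survives g V Q Q-tail Q-large (a ∷ ρ) u@(_ ∷ u′) agree Qρ with m ≤? length ρ
  ... | no  m≰l = ≤-reflexive (sym (Event.survives-early g V (a ∷ ρ) (≰⇒> m≰l)))
  ... | yes m≤l = begin
    1
      ≤⟨ agree⇒survives g V Q Q-tail Q-large ρ u′ (agree-tail V a ρ u agree) (Q-tail a ρ m≤l Qρ) ⟩
    Event.survives g V ρ
      ≡⟨ *-identityˡ _ ⟨
    1 * Event.survives g V ρ
      ≡⟨ cong (_* Event.survives g V ρ) allowed≡1 ⟨
    allowed g V (a ∷ ρ) a * Event.survives g V ρ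
      ≡⟨ Event.survives-∷ g V a ρ m≤l ⟨
    Event.survives g V (a ∷ ρ) ∎
    where
    open ≤-Reasoning
    large : (2 ^ (g + ∑ (a ∷ ρ) (𝟙 ∘ lookup V)) ≤ᵇ Ψ (a ∷ ρ) (restrict V (a ∷ ρ))) ≡ true
    large rewrite agree⇒count V (a ∷ ρ) u agree | agree⇒restrict V (a ∷ ρ) u agree =
      T⇒≡true (≤⇒≤ᵇ (Q-large (a ∷ ρ) Qρ))
    last-allowed : lookup V a ∨ not (good (a ∷ ρ) (restrict V (a ∷ ρ)) a) ≡ true
    last-allowed with lookup V a in eq
    ... | true  = refl
    -- As `a` lies outside V, the restriction to `a ∷ ρ` is that to `ρ`, which is the selection
    -- against which `a` was tested and rejected.
    ... | false = cong not (≡.trans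
      (cong (λ R → good (a ∷ ρ) R a) (agree⇒restrict V ρ u′ (agree-tail V a ρ u agree)))
      (≡.trans (sym (accepts-late ρ (selected ρ) a m≤l)) (≡.trans (sym (agree-head V a ρ u agree)) eq)))
    allowed≡1 : allowed g V (a ∷ ρ) a ≡ 1
    allowed≡1 = cong 𝟙 (cong₂ _∧_ large last-allowed)

  -- Comparison with a feasible set

  module Optimum (S : Subset n) (FS : F S ≡ true) where

    s : Fin n → ℕ
    s i = if lookup S i then y i else 0

    k = setValue y S

    s≤1 : ∀ i → s i ≤ 1
    s≤1 i with lookup S i
    ... | true  = y≤1 i
    ... | false = z≤n

    ∑s≡k : ∀ ρ → ρ ↭ allFin n → ∑ ρ s ≡ k
    ∑s≡k ρ p = ≡.trans (∑-↭ s p) (sym (setValue≡∑ y S))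

    -- Any set T of value-1 items of S may be added: W ∪ T lies in W ∪ S.
    2^∑s≤Ψ : ∀ xs W → F (W ∪ S) ≡ true → 2 ^ ∑ xs s ≤ Ψ xs W
    2^∑s≤Ψ []       W FW∪S = ≤-reflexive (sym (cong 𝟙 (F-∪ˡ down W S FW∪S)))
    2^∑s≤Ψ (x ∷ xs) W FW∪S with lookup S x in x∈S | y x | y≤1 x
    ... | false | v     | _       = ≤-trans (2^∑s≤Ψ xs W FW∪S) (m≤m+n _ _)
    ... | true  | zero  | _       = ≤-trans (2^∑s≤Ψ xs W FW∪S) (m≤m+n _ _)
    ... | true  | suc 0 | s≤s z≤n = +-mono-≤ (2^∑s≤Ψ xs W FW∪S)
      (+-monoˡ-≤ 0 (2^∑s≤Ψ xs (W ∪ ⁅ x ⁆) (down _ (W ∪ S) absorb FW∪S)))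
      where
      absorb : (W ∪ ⁅ x ⁆) ∪ S ⊆ W ∪ S
      absorb {z} z∈ with x∈p∪q⁻ (W ∪ ⁅ x ⁆) S z∈
      ... | inj₂ z∈S = q⊆p∪q W S z∈S
      ... | inj₁ z∈Wx with x∈p∪q⁻ W ⁅ x ⁆ z∈Wx
      ...   | inj₁ z∈W = p⊆p∪q S z∈W
      ...   | inj₂ z∈x rewrite x∈⁅y⁆⇒x≡y x z∈x = q⊆p∪q W S (lookup⇒[]= x S x∈S)

    F[⊥∪S] : F (⊥ ∪ S) ≡ true
    F[⊥∪S] = ≡.trans (cong F (∪-identityˡ S)) FS

    none-accepted : ∀ ρ → accepted ρ ≡ 0 → selected ρ ≡ ⊥
    none-accepted []      _ = refl
    none-accepted (a ∷ ρ) eq with accepts ρ (selected ρ) a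
    ... | false = none-accepted ρ eq

    -- The bound 2 says that some nonempty set of arrived items of value 1 is feasible, besides the
    -- empty set.
    Idle : List (Fin n) → Set
    Idle ρ = accepted ρ ≡ 0 × 2 ≤ Ψ ρ ⊥

    -- The first item whose arrival makes Ψ(∅) exceed 1 is good.
    idle-tail : ∀ a ρ → m ≤ length ρ → Idle (a ∷ ρ) → Idle ρ
    idle-tail a ρ m≤l (none , 2≤Ψ) with accepts ρ (selected ρ) a in eq
    ... | false = none , ≮⇒≥ λ Ψ<2 → first-good Ψ<2
      where
      open ≤-Reasoning
      P = Ψ ρ (⊥ ∪ ⁅ a ⁆)
      ¬good : good (a ∷ ρ) ⊥ a ≡ false
      ¬good = ≡.trans (cong (λ W → good (a ∷ ρ) W a) (sym (none-accepted ρ none)))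
                      (≡.trans (sym (accepts-late ρ (selected ρ) a m≤l)) eq)
      first-good : ¬ (Ψ ρ ⊥ < 2)
      -- Ψ rises from at most 1 to at least 2, so `y a * P` is at least 1 and the new Ψ is at most
      -- twice `y a * P`; 2^q ≥ 4 then makes `a` good.
      first-good (s≤s Ψ≤1) = subst T ¬good (<⇒<ᵇ (begin-strict
        Ψ ρ ⊥ + y a * P
          ≤⟨ +-monoˡ-≤ (y a * P) (≤-trans Ψ≤1 0<yP) ⟩
        y a * P + y a * P
          <⟨ m<m+n (y a * P + y a * P) (≤-trans 0<yP (m≤m+n (y a * P) (y a * P))) ⟩
        y a * P + y a * P + (y a * P + y a * P)
          ≡⟨ four (y a) P ⟩
        4 * (y a * P)
          ≤⟨ *-mono-≤ (^-monoʳ-≤ 2 {2} {q} (s≤s (s≤s z≤n))) (*-monoʳ-≤ (y a) (Ψ-≤-∷ a ρ (⊥ ∪ ⁅ a ⁆))) ⟩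
        2 ^ q * (y a * Ψ (a ∷ ρ) (⊥ ∪ ⁅ a ⁆)) ∎))
        where
        0<yP : 0 < y a * P
        0<yP = +-cancelˡ-≤ 1 1 (y a * P) (≤-trans 2≤Ψ (+-monoˡ-≤ (y a * P) Ψ≤1))
        four : ∀ a p → a * p + a * p + (a * p + a * p) ≡ 4 * (a * p)
        four = solve-∀

    idle-large : ∀ ρ → Idle ρ → 2 ^ (1 + accepted ρ) ≤ Ψ ρ (selected ρ)
    idle-large ρ (none , 2≤Ψ) rewrite none | none-accepted ρ none = 2≤Ψ

    -- Each order either accepts an item or survives for `V = ⊥` and `g = 1`, which at most half of
    -- the orders do.
    n!≤2∑accepted : 0 < k → 0 < n → n ! ≤ 2 * ∑accepted
    n!≤2∑accepted 0<k 0<n = +-cancelʳ-≤ (n !) _ _ (begin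
      n ! + n !                    ≡⟨ double (n !) ⟩
      2 * (n ! * 1)                ≡⟨ cong (2 *_) (∑-histories-const n (allFin n) 1 length-allFin) ⟨
      2 * ∑-histories n (allFin n) (const 1)
        ≤⟨ *-monoʳ-≤ 2 (∑-histories-mono n (allFin n) length-allFin one≤) ⟩
      2 * ∑-histories n (allFin n) (λ ρ → accepted ρ + Event.survives 1 ⊥ ρ)
        ≡⟨ cong (2 *_) (∑-histories-+ n (allFin n) accepted (Event.survives 1 ⊥)) ⟩
      2 * (∑accepted + E)          ≡⟨ *-distribˡ-+ 2 ∑accepted E ⟩
      2 * ∑accepted + 2 * E        ≡⟨ cong (2 * ∑accepted +_) (*-comm 2 E) ⟩
      2 * ∑accepted + E * 2 ^ 1    ≤⟨ +-monoʳ-≤ (2 * ∑accepted) (∑-event 1 ⊥ 0<n) ⟩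
      2 * ∑accepted + n !          ∎)
      where
      open ≤-Reasoning
      E = ∑-histories n (allFin n) (Event.survives 1 ⊥)
      double : ∀ a → a + a ≡ 2 * (a * 1)
      double = solve-∀
      one≤ : ∀ ρ → ρ ↭ allFin n → 1 ≤ accepted ρ + Event.survives 1 ⊥ ρ
      one≤ ρ p with accepted ρ in none
      ... | suc _ = s≤s z≤n
      ... | zero  = agree⇒survives 1 ⊥ Idle idle-tail idle-large ρ (unique-order p)
        (λ {x} _ → cong (λ W → lookup W x) (sym (none-accepted ρ none)))
        (none , ≤-trans (^-monoʳ-≤ 2 (subst (1 ≤_) (sym (∑s≡k ρ p)) 0<k)) (2^∑s≤Ψ ρ ⊥ F[⊥∪S]))

    -- This is k′ for the set `S`.
    sampled : List (Fin n) → ℕ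
    sampled []      = 0
    sampled (a ∷ ρ) = if m ≤ᵇ length ρ then sampled ρ else s a + sampled ρ

    sampled-late : ∀ a ρ → m ≤ length ρ → sampled (a ∷ ρ) ≡ sampled ρ
    sampled-late a ρ m≤l = cong (λ b → if b then sampled ρ else s a + sampled ρ) (T⇒≡true (≤⇒≤ᵇ m≤l))

    sampled-early : ∀ ρ → length ρ ≤ m → sampled ρ ≡ ∑ ρ s
    sampled-early []      l≤m = refl
    sampled-early (a ∷ ρ) l<m = ≡.trans
      (cong (λ b → if b then sampled ρ else s a + sampled ρ) (¬T⇒≡false λ t → <⇒≱ l<m (≤ᵇ⇒≤ m (length ρ) t)))
      (cong (s a +_) (sampled-early ρ (<⇒≤ l<m)))

    sampled≤∑s : ∀ ρ → sampled ρ ≤ ∑ ρ s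
    sampled≤∑s []      = z≤n
    sampled≤∑s (a ∷ ρ) with m ≤ᵇ length ρ
    ... | true  = ≤-trans (sampled≤∑s ρ) (m≤n+m _ (s a))
    ... | false = +-monoʳ-≤ (s a) (sampled≤∑s ρ)

    early⇒idle : ∀ ρ → length ρ ≤ m → accepted ρ ≡ 0
    early⇒idle []      l≤m = refl
    early⇒idle (a ∷ ρ) l<m rewrite accepts-early ρ (selected ρ) a l<m = early⇒idle ρ (<⇒≤ l<m)

    -- The induction starts at the end of the sample, where nothing is selected and `2^∑s≤Ψ`
    -- applies; each acceptance then costs a factor 2^q by the definition of good.
    2^sampled≤ : ∀ ρ → 2 ^ sampled ρ ≤ Ψ ρ (selected ρ) * 2 ^ (q * accepted ρ)
    2^sampled≤-early : ∀ ρ → length ρ ≤ m → 2 ^ sampled ρ ≤ Ψ ρ (selected ρ) * 2 ^ (q * accepted ρ)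
    2^sampled≤-early ρ l≤m
      rewrite sampled-early ρ l≤m | early⇒idle ρ l≤m | none-accepted ρ (early⇒idle ρ l≤m) | *-zeroʳ q
            | *-identityʳ (Ψ ρ ⊥) = 2^∑s≤Ψ ρ ⊥ F[⊥∪S]
    2^sampled≤ []      = 2^sampled≤-early [] z≤n
    2^sampled≤ (a ∷ ρ) with m ≤? length ρ
    ... | no  m≰l = 2^sampled≤-early (a ∷ ρ) (≰⇒> m≰l)
    ... | yes m≤l rewrite sampled-late a ρ m≤l with accepts ρ (selected ρ) a in eq
    ...   | false = ≤-trans (2^sampled≤ ρ) (*-monoˡ-≤ _ (Ψ-≤-∷ a ρ (selected ρ)))
    ...   | true  = begin
      2 ^ sampled ρ
        ≤⟨ 2^sampled≤ ρ ⟩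
      Ψ ρ W * 2 ^ (q * accepted ρ)
        ≤⟨ *-monoˡ-≤ _ (Ψ-≤-∷ a ρ W) ⟩
      Ψ (a ∷ ρ) W * 2 ^ (q * accepted ρ)
        ≤⟨ *-monoˡ-≤ _ (<⇒≤ (good⇒< down (a ∷ ρ) W a (accepts⇒good ρ W a eq))) ⟩
      2 ^ q * (y a * Ψ (a ∷ ρ) (W ∪ ⁅ a ⁆)) * 2 ^ (q * accepted ρ)
        ≤⟨ *-monoˡ-≤ _ (*-monoʳ-≤ (2 ^ q) (*-monoˡ-≤ _ (y≤1 a))) ⟩
      2 ^ q * (1 * Ψ (a ∷ ρ) (W ∪ ⁅ a ⁆)) * 2 ^ (q * accepted ρ)
        ≡⟨ regroup (2 ^ q) (Ψ (a ∷ ρ) (W ∪ ⁅ a ⁆)) (2 ^ (q * accepted ρ)) ⟩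
      Ψ (a ∷ ρ) (W ∪ ⁅ a ⁆) * (2 ^ q * 2 ^ (q * accepted ρ))
        ≡⟨ cong (Ψ (a ∷ ρ) (W ∪ ⁅ a ⁆) *_) (^-distribˡ-+-* 2 q (q * accepted ρ)) ⟨
      Ψ (a ∷ ρ) (W ∪ ⁅ a ⁆) * 2 ^ (q + q * accepted ρ)
        ≡⟨ cong (λ e → Ψ (a ∷ ρ) (W ∪ ⁅ a ⁆) * 2 ^ e) (*-suc q (accepted ρ)) ⟨
      Ψ (a ∷ ρ) (W ∪ ⁅ a ⁆) * 2 ^ (q * suc (accepted ρ)) ∎
      where
      open ≤-Reasoning
      W = selected ρ
      regroup : ∀ a b c → a * (1 * b) * c ≡ b * (a * c)
      regroup = solve-∀

    -- Makes the union bound over V sum to (1 + 2^-q)^n / 32 ≤ 1/16.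
    gap : Subset n → ℕ
    gap V = q * ∣ V ∣ + 5

    -- The number of sets V whose event occurs, an upper bound for the indicator that some event
    -- occurs.
    atypical : List (Fin n) → ℕ
    atypical ρ = ∑ (subsets n) (λ V → Event.survives (gap V) V ρ)

    16∑atypical≤n! : 0 < n → 16 * ∑-histories n (allFin n) atypical ≤ n !
    16∑atypical≤n! 0<n = *-cancelʳ-≤ _ _ (2 * N ^ n) {{m*n≢0 2 (N ^ n) {{_}} {{m^n≢0 N n {{m^n≢0 2 q}}}}}} (begin
      16 * ∑-histories n (allFin n) atypical * (2 * N ^ n)
        ≡⟨ cong (λ z → 16 * z * (2 * N ^ n)) (∑-histories-∑ n (allFin n) (subsets n) (λ V → Event.survives (gap V) V)) ⟩
      16 * ∑ (subsets n) f * (2 * N ^ n)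
        ≡⟨ regroup (∑ (subsets n) f) (N ^ n) ⟩
      32 * ∑ (subsets n) f * N ^ n
        ≡⟨ cong (_* N ^ n) (∑-*ˡ 32 (subsets n) f) ⟨
      ∑ (subsets n) (λ V → 32 * f V) * N ^ n
        ≤⟨ ∑-subsets-geometric n (n !) N (λ V → 32 * f V) each ⟩
      n ! * suc N ^ n
        ≤⟨ *-monoʳ-≤ (n !) ([1+c]^n≤2c^n n N (m^n>0 2 q) 2n≤N) ⟩
      n ! * (2 * N ^ n) ∎)
      where
      open ≤-Reasoning
      N = 2 ^ q
      f : Subset n → ℕ
      f V = ∑-histories n (allFin n) (Event.survives (gap V) V)
      regroup : ∀ a b → 16 * a * (2 * b) ≡ 32 * a * b
      regroup = solve-∀
      2n≤N : n + n ≤ N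
      2n≤N = begin
        n + n                       ≤⟨ +-mono-≤ n≤ n≤ ⟩
        2 ^ suc l + 2 ^ suc l       ≡⟨ cong (2 ^ suc l +_) (+-identityʳ _) ⟨
        N                           ∎
        where
        l = ⌊log₂ n ⌋
        n≤ : n ≤ 2 ^ suc l
        n≤ = <⇒≤ (n<2^[1+⌊log₂n⌋] n)
      each : ∀ V → 32 * f V * N ^ ∣ V ∣ ≤ n !
      each V = begin
        32 * f V * N ^ ∣ V ∣            ≡⟨ rotate (f V) (N ^ ∣ V ∣) ⟩
        f V * (N ^ ∣ V ∣ * 32)          ≡⟨ cong (λ z → f V * (z * 32)) (^-*-assoc 2 q ∣ V ∣) ⟩
        f V * (2 ^ (q * ∣ V ∣) * 2 ^ 5) ≡⟨ cong (f V *_) (^-distribˡ-+-* 2 (q * ∣ V ∣) 5) ⟨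
        f V * 2 ^ gap V                 ≤⟨ ∑-event (gap V) V 0<n ⟩
        n !                             ∎
        where
        rotate : ∀ a b → 32 * a * b ≡ a * (b * 32)
        rotate = solve-∀

    -- If the first term is too small, the event of the final selection itself occurs, so
    -- `atypical ρ ≥ 1` and the trivial bound `k` applies.
    sampled≤ : ∀ ρ → ρ ↭ allFin n → sampled ρ ≤ 3 * q * (accepted ρ + 1) + k * atypical ρ
    sampled≤ ρ p with sampled ρ ≤? 3 * q * (accepted ρ + 1)
    ... | yes small = ≤-trans small (m≤m+n _ _)
    ... | no  large = begin
      sampled ρ                                     ≤⟨ sampled≤∑s ρ ⟩
      ∑ ρ s                                         ≡⟨ ∑s≡k ρ p ⟩
      k                                             ≡⟨ *-identityʳ k ⟨
      k * 1                                         ≤⟨ *-monoʳ-≤ k 1≤atypical ⟩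
      k * atypical ρ                                ≤⟨ m≤n+m _ _ ⟩
      3 * q * (accepted ρ + 1) + k * atypical ρ     ∎
      where
      open ≤-Reasoning
      V = selected ρ
      v = ∣ V ∣
      -- Stated with the final count `v`: going back in time `accepted` can only drop, and `sampled`
      -- does not change until the sample is reached.
      Stuck : List (Fin n) → Set
      Stuck τ = accepted τ ≤ v × 3 * q * (v + 1) ≤ sampled τ
      stuck-tail : ∀ a τ → m ≤ length τ → Stuck (a ∷ τ) → Stuck τ
      stuck-tail a τ m≤l (acc≤ , ≤sam) =
        ≤-trans (m≤n+m (accepted τ) _) acc≤ , subst (3 * q * (v + 1) ≤_) (sampled-late a τ m≤l) ≤sam
      stuck-large : ∀ τ → Stuck τ → 2 ^ (gap V + accepted τ) ≤ Ψ τ (selected τ)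
      stuck-large τ (acc≤ , ≤sam) = *-cancelʳ-≤ _ _ (2 ^ (q * accepted τ)) {{m^n≢0 2 (q * accepted τ)}} (begin
        2 ^ (gap V + accepted τ) * 2 ^ (q * accepted τ)
          ≡⟨ ^-distribˡ-+-* 2 (gap V + accepted τ) (q * accepted τ) ⟨
        2 ^ (gap V + accepted τ + q * accepted τ)
          ≤⟨ ^-monoʳ-≤ 2 (≤-trans exponent ≤sam) ⟩
        2 ^ sampled τ
          ≤⟨ 2^sampled≤ τ ⟩
        Ψ τ (selected τ) * 2 ^ (q * accepted τ) ∎)
        where
        2≤q : 2 ≤ q
        2≤q = m≤m+n 2 _
        expand : ∀ q v → q * v + 3 * q + q * v + q * v ≡ 3 * q * (v + 1)
        expand = solve-∀
        -- Each of q v, `accepted τ` and `q * accepted τ` is at most q v; the 5 in `gap` is at most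
        -- 3 q because q ≥ 2.
        exponent : gap V + accepted τ + q * accepted τ ≤ 3 * q * (v + 1)
        exponent = begin
          q * v + 5 + accepted τ + q * accepted τ
            ≤⟨ +-mono-≤ (+-mono-≤ (+-monoʳ-≤ (q * v) (≤-trans (n≤1+n 5) (*-monoʳ-≤ 3 2≤q)))
                                  (≤-trans acc≤ (m≤n*m v q)))
                        (*-monoʳ-≤ q acc≤) ⟩
          q * v + 3 * q + q * v + q * v
            ≡⟨ expand q v ⟩
          3 * q * (v + 1) ∎
      1≤atypical : 1 ≤ atypical ρ
      1≤atypical = ≤-trans
        (agree⇒survives (gap V) V Stuck stuck-tail stuck-large ρ (unique-order p) (λ _ → refl)
          (≤-reflexive (sym (∣selected∣ ρ p)) ,
           subst (λ c → 3 * q * (c + 1) ≤ sampled ρ) (sym (∣selected∣ ρ p)) (≰⇒≥ large)))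
        (≤∑-subsets (λ V → Event.survives (gap V) V ρ) V)

    -- Each item is sampled with probability m/(t+1). Backwards: removing a random last element from
    -- t+2 elements keeps each with probability (t+1)/(t+2), until `m` remain.
    ∑-sampled : ∀ t xs → m ≤ suc t → length xs ≡ suc t →
                m * t ! * ∑ xs s ≤ ∑-histories (suc t) xs sampled
    ∑-sampled t xs m≤ l with m≤n⇒m<n∨m≡n m≤
    ... | inj₂ m≡ = begin
      m * t ! * ∑ xs s                            ≡⟨ cong (λ z → z * t ! * ∑ xs s) m≡ ⟩
      suc t ! * ∑ xs s                            ≡⟨ ∑-histories-const (suc t) xs (∑ xs s) l ⟨
      ∑-histories (suc t) xs (const (∑ xs s))     ≤⟨ ∑-histories-mono (suc t) xs l (λ ρ p → ≤-reflexive
        (≡.trans (∑-↭ s (↭-sym p)) (sym (sampled-early ρ (≤-reflexive (≡.trans (↭-length p) (≡.trans l (sym m≡)))))))) ⟩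
      ∑-histories (suc t) xs sampled              ∎
      where open ≤-Reasoning
    -- Here `m` is 0 and the left side vanishes.
    ∑-sampled zero xs m≤ l | inj₁ (s≤s m≤0) =
      subst (λ z → z * 1 * ∑ xs s ≤ ∑-histories 1 xs sampled) (sym (n≤0⇒n≡0 m≤0)) z≤n
    ∑-sampled (suc t) xs@(x ∷ zs) m≤ l | inj₁ (s≤s m≤t) = begin
      m * (suc t * t !) * ∑ xs s
        ≡⟨ regroup m (suc t) (t !) (∑ xs s) ⟩
      m * t ! * (suc t * ∑ xs s)
        ≡⟨ cong (λ z → m * t ! * (z * ∑ xs s)) (suc-injective l) ⟨
      m * t ! * (length zs * ∑ xs s)
        ≡⟨ cong (m * t ! *_) (∑-picks-∑ x zs s) ⟨
      m * t ! * ∑ (picks xs) (λ (_ , r) → ∑ r s)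
        ≡⟨ ∑-*ˡ (m * t !) (picks xs) _ ⟨
      ∑ (picks xs) (λ (_ , r) → m * t ! * ∑ r s)
        ≤⟨ ∑-mono-All (All.map (λ {(a , r)} p → step a r (pick-length l p)) (picks-↭ xs)) ⟩
      ∑-histories (suc (suc t)) xs sampled ∎
      where
      open ≤-Reasoning
      regroup : ∀ a b c d → a * (b * c) * d ≡ a * c * (b * d)
      regroup = solve-∀
      step : ∀ a r → length r ≡ suc t → m * t ! * ∑ r s ≤ ∑-histories (suc t) r (sampled ∘ (a ∷_))
      step a r lr = ≤-trans (∑-sampled t r m≤t lr)
        (∑-histories-mono (suc t) r lr λ ρ p → ≤-reflexive
          (sym (sampled-late a ρ (subst (m ≤_) (sym (≡.trans (↭-length p) lr)) m≤t))))

    ∑-sampled≤ : ∑-histories n (allFin n) sampled ≤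
                 3 * q * (∑accepted + n !) + k * ∑-histories n (allFin n) atypical
    ∑-sampled≤ = begin
      ∑-histories n (allFin n) sampled
        ≤⟨ ∑-histories-mono n (allFin n) length-allFin sampled≤ ⟩
      ∑-histories n (allFin n) (λ ρ → 3 * q * (accepted ρ + 1) + k * atypical ρ)
        ≡⟨ ∑-histories-+ n (allFin n) (λ ρ → 3 * q * (accepted ρ + 1)) (λ ρ → k * atypical ρ) ⟩
      ∑-histories n (allFin n) (λ ρ → 3 * q * (accepted ρ + 1)) + ∑-histories n (allFin n) (λ ρ → k * atypical ρ)
        ≡⟨ cong₂ _+_ (≡.trans (∑-histories-*ˡ (3 * q) n (allFin n) (λ ρ → accepted ρ + 1))
                       (cong (3 * q *_) (∑-histories-+ n (allFin n) accepted (const 1))))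
                     (∑-histories-*ˡ k n (allFin n) atypical) ⟩
      3 * q * (∑accepted + ∑-histories n (allFin n) (const 1)) + k * ∑-histories n (allFin n) atypical
        ≡⟨ cong (λ z → 3 * q * (∑accepted + z) + k * ∑-histories n (allFin n) atypical)
                (≡.trans (∑-histories-const n (allFin n) 1 length-allFin) (*-identityʳ (n !))) ⟩
      3 * q * (∑accepted + n !) + k * ∑-histories n (allFin n) atypical ∎
      where open ≤-Reasoning

    k≤n : k ≤ n
    k≤n = begin
      k                              ≡⟨ setValue≡∑ y S ⟩
      ∑ (allFin n) s                 ≤⟨ ∑-mono (allFin n) s≤1 ⟩
      ∑ (allFin n) (const 1)         ≡⟨ ∑-const 1 (allFin n) ⟩
      length (allFin n) * 1          ≡⟨ *-identityʳ _ ⟩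
      length (allFin n)              ≡⟨ length-allFin ⟩
      n                              ∎
      where open ≤-Reasoning

    -- As n ≤ 3m, the expectation of `sampled` is at least k/3. Atypical orders account for at most
    -- k/16 of it, and the rest is at most 3q times one more than the expected number of
    -- acceptances.
    k*n!≤54q∑accepted : 0 < k → ∀ t → n ≡ suc t → n ≤ 3 * m → k * n ! ≤ 54 * q * ∑accepted
    k*n!≤54q∑accepted 0<k t n≡ n≤3m = *-cancelˡ-≤ 8 (+-cancelʳ-≤ (8 * K) _ _ (begin
      8 * K + 8 * K
        ≡⟨ sixteen K ⟩
      16 * (k * n !)
        ≡⟨ cong (λ z → 16 * (k * z)) n!≡ ⟩
      16 * (k * (n * t !))
        ≤⟨ *-monoʳ-≤ 16 (*-monoʳ-≤ k (*-monoˡ-≤ (t !) n≤3m)) ⟩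
      16 * (k * (3 * m * t !))
        ≡⟨ regroup k m (t !) ⟩
      48 * (m * t ! * k)
        ≤⟨ *-monoʳ-≤ 48 (≤-trans ∑-sampled-n ∑-sampled≤) ⟩
      48 * (3 * q * (∑accepted + n !) + k * E)
        ≡⟨ expand q (∑accepted + n !) k E ⟩
      144 * q * (∑accepted + n !) + 3 * (k * (16 * E))
        -- The "+ 1" becomes `2 * ∑accepted`. The atypical part, at most 3 K, is relaxed to 8 K so
        -- that 8 K remains after cancelling; 144 * 3 = 8 * 54.
        ≤⟨ +-mono-≤ (*-monoʳ-≤ (144 * q) (+-monoʳ-≤ ∑accepted (n!≤2∑accepted 0<k 0<n)))
                    (*-mono-≤ {3} {8} (m≤m+n 3 5) (*-monoʳ-≤ k (16∑atypical≤n! 0<n))) ⟩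
      144 * q * (∑accepted + 2 * ∑accepted) + 8 * K
        ≡⟨ cong (_+ 8 * K) (collect q ∑accepted) ⟩
      8 * (54 * q * ∑accepted) + 8 * K ∎))
      where
      open ≤-Reasoning
      K = k * n !
      E = ∑-histories n (allFin n) atypical
      0<n : 0 < n
      0<n = subst (0 <_) (sym n≡) (s≤s z≤n)
      n!≡ : n ! ≡ n * t !
      n!≡ = ≡.trans (cong _! n≡) (cong (_* t !) (sym n≡))
      ∑-sampled-n : m * t ! * k ≤ ∑-histories n (allFin n) sampled
      ∑-sampled-n = subst₂ (λ v l → m * t ! * v ≤ ∑-histories l (allFin n) sampled)
        (sym (setValue≡∑ y S)) (sym n≡)
        (∑-sampled t (allFin n) (subst (m ≤_) n≡ (⌊n/2⌋≤n n)) (≡.trans length-allFin n≡))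
      sixteen : ∀ a → 8 * a + 8 * a ≡ 16 * a
      sixteen = solve-∀
      regroup : ∀ k m f → 16 * (k * (3 * m * f)) ≡ 48 * (m * f * k)
      regroup = solve-∀
      expand : ∀ q a k e → 48 * (3 * q * a + k * e) ≡ 144 * q * a + 3 * (k * (16 * e))
      expand = solve-∀
      collect : ∀ q a → 144 * q * (a + 2 * a) ≡ 8 * (54 * q * a)
      collect = solve-∀

-- Small cases and constants

n≤3⌊n/2⌋ : ∀ n → 2 + n ≤ 3 * ⌊ 2 + n /2⌋
n≤3⌊n/2⌋ zero          = s≤s (s≤s z≤n)
n≤3⌊n/2⌋ (suc zero)    = ≤-refl
n≤3⌊n/2⌋ (suc (suc n)) = begin
  2 + (2 + n)                ≤⟨ +-mono-≤ (n≤1+n 2) (n≤3⌊n/2⌋ n) ⟩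
  3 + 3 * ⌊ 2 + n /2⌋        ≡⟨ *-suc 3 ⌊ 2 + n /2⌋ ⟨
  3 * ⌊ 2 + (2 + n) /2⌋      ∎
  where open ≤-Reasoning

-- A bound for every feasible `S` covers the maximum. Both sides carry the factor n!, and the "+ 1"
-- keeps the ratio positive for n = 1, where the logarithm is 0.
theorem3p2 : Σ OnlineAlg λ A → ∃ λ (C : ℕ) →
    (n : ℕ) (F : Family n) (y : Fin n → ℕ) →
    DownwardClosed F → (∀ i → y i ≤ 1) →
    (S : Subset n) → F S ≡ true →
    setValue y S * (n !) ≤ C * (⌊log₂ n ⌋ + 1) * totalAlgValue A y F
theorem3p2 = algorithm , 108 , bound
  where
  open ≤-Reasoning
  bound : (n : ℕ) (F : Family n) (y : Fin n → ℕ) →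
    DownwardClosed F → (∀ i → y i ≤ 1) →
    (S : Subset n) → F S ≡ true →
    setValue y S * (n !) ≤ 108 * (⌊log₂ n ⌋ + 1) * totalAlgValue algorithm y F
  bound n F y down y≤1 S FS = ≤-trans (against n F y down y≤1 S FS)
    (*-monoʳ-≤ (108 * (⌊log₂ n ⌋ + 1)) (Analysis.∑accepted≤totalAlgValue F y down y≤1))
    where
    against : ∀ n F y down y≤1 S (FS : F S ≡ true) →
      setValue y S * n ! ≤ 108 * (⌊log₂ n ⌋ + 1) * Analysis.∑accepted {n} F y down y≤1
    against n F y down y≤1 S FS with setValue y S in k≡
    ... | zero = z≤n
    against zero F y down y≤1 [] FS | suc _ = contradiction k≡ λ ()
    -- For n = 1 the sample is empty and n ≤ 3m fails, but k ≤ 1, so accepting an item with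
    -- probability at least 1/2 is enough.
    against (suc zero) F y down y≤1 S FS | suc j = begin
      suc j * 1          ≡⟨ *-identityʳ (suc j) ⟩
      suc j              ≡⟨ k≡ ⟨
      setValue y S       ≤⟨ k≤n ⟩
      1                  ≤⟨ n!≤2∑accepted (subst (0 <_) (sym k≡) (s≤s z≤n)) (s≤s z≤n) ⟩
      2 * ∑accepted      ≤⟨ *-monoˡ-≤ ∑accepted (m≤m+n 2 106) ⟩
      108 * ∑accepted    ∎
      where
      open Analysis F y down y≤1
      open Optimum S FS
    against n@(suc (suc t)) F y down y≤1 S FS | suc j = begin
      suc j * n !                              ≡⟨ cong (_* n !) k≡ ⟨
      setValue y S * n !                       ≤⟨ k*n!≤54q∑accepted (subst (0 <_) (sym k≡) (s≤s z≤n)) (suc t) refl (n≤3⌊n/2⌋ t) ⟩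
      -- With q = 2 + l, doubling l gives 54 (2 + 2l) = 108 (l + 1), the source of the constant.
      54 * (2 + l) * ∑accepted                 ≤⟨ *-monoˡ-≤ ∑accepted (*-monoʳ-≤ 54 (+-monoʳ-≤ 2 (m≤n*m l 2))) ⟩
      54 * (2 + 2 * l) * ∑accepted             ≡⟨ cong (_* ∑accepted) (double l) ⟩
      108 * (l + 1) * ∑accepted                ∎
      where
      open Analysis F y down y≤1
      open Optimum S FS
      l = ⌊log₂ n ⌋
      double : ∀ l → 54 * (2 + 2 * l) ≡ 108 * (l + 1)
      double = solve-∀
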